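{- Let $p,q,l$ be positive integers and let $\mathcal{P}$ be a nonnegative symmetric sign pattern (all entries in $\{+,0\}$) with all diagonal entries equal to $0$ whose underlying graph $G(\mathcal{P})$ is the dumbbell graph $D_{4p+2,4q+2,2l-1}$, i.e. the graph consisting of two vertex-disjoint cycles of lengths $4p+2$ and $4q+2$ joined by a path of length $2l+1$ (having $2l$ internal vertices) that shares only its two end vertices with the cycles, one with each cycle. Then $\mathcal{P}$ requires full $P$-vertices.
   Context: A sign pattern of order $N$ is an $N\times N$ matrix $\mathcal{P}=[p_{ij}]$ with entries in $\{+,-,0\}$; it is symmetric if $p_{ij}=p_{ji}$ for all $i,j$. $\mathcal{Q}_{\mathrm{SYM}}(\mathcal{P})$ is the set of all real symmetric $N\times N$ matrices $A=[a_{ij}]$ with $\mathrm{sgn}(a_{ij})=p_{ij}$ for all $i,j$. The underlying graph $G(\mathcal{P})$ is the undirected graph on vertices $v_1,\dots,v_N$ with an edge $\{v_i,v_j\}$ exactly when $p_{ij}\neq 0$. For $a,b\ge 3$ and $c\ge -1$, the dumbbell graph $D_{a,b,c}$ is the bicyclic graph obtained from two vertex-disjoint cycles $C_a$ and $C_b$ by joining them by a path $u_1,v_1,\dots,v_{c+1},w_1$ with $c+3$ vertices (so with $c+2$ edges) having only its end vertices $u_1\in V(C_a)$ and $w_1\in V(C_b)$ in common with the two cycles. For a real symmetric matrix $A$, $m_A(0)$ is the algebraic multiplicity of $0$ as an eigenvalue of $A$ (zero if $0$ is not an eigenvalue), and $A(j)$ is the principal submatrix obtained by deleting row and column $j$.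 The vertex $v_j$ is a $P$-vertex of $A$ if $m_{A(j)}(0)-m_A(0)=1$. The pattern $\mathcal{P}$ of order $N$ requires full $P$-vertices if, for every $A\in\mathcal{Q}_{\mathrm{SYM}}(\mathcal{P})$, all $N$ vertices are $P$-vertices of $A$. -}

module Defs where

open import Algebra.Bundles using (CommutativeMonoid)
open import Algebra.Bundles.Raw using (RawRing)
import Algebra.Definitions.RawSemiring as RawSemiringOps
import Algebra.Properties.CommutativeSemigroup as CommutativeSemigroupProperties
open import Data.Bool.Base using (if_then_else_)
open import Data.Fin.Base using (Fin; zero; suc; toℕ; punchIn)
open import Data.Fin.Properties using (_≟_)
open import Data.Integer.Base as ℤ using (1ℤ)
open import Data.List.Base using (List; []; _∷_; map; foldr)
open import Data.Nat.Base as ℕ using (ℕ; zero; suc; pred; _⊔_)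
import Data.Nat.Properties as ℕ
open import Data.Product.Base using (Σ-syntax; ∃-syntax; _×_; _,_)
open import Data.Rational.Base as ℚ using (ℚ; 0ℚ; 1ℚ; ½; ∣_∣)
import Data.Rational.Properties as ℚ
open import Data.Sum.Base using (_⊎_)
open import Function.Bundles using (_↔_; _⇔_; Inverse)
open import Level using (Level; 0ℓ)
import Level as L
open import Relation.Binary.Construct.Closure.Symmetric using (SymClosure; symmetric)
open import Relation.Binary.Core using (Rel)
open import Relation.Binary.Definitions using (Symmetric)
open import Relation.Binary.PropositionalEquality
open import Relation.Nullary using (¬_; does)

-- Real numbers: Cauchy sequences of rationals modulo null sequences

Cauchy : (ℕ → ℚ) → Set
Cauchy x = ∀ ε → 0ℚ ℚ.< ε →
  ∃[ N ] ∀ m n → N ℕ.≤ m → N ℕ.≤ n → ∣ x m ℚ.- x n ∣ ℚ.< ε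

record ℝ : Set where
  constructor mkℝ
  field
    seq    : ℕ → ℚ
    cauchy : Cauchy seq

open ℝ public

infix 4 _≈ℝ_ _<ℝ_

_≈ℝ_ : Rel ℝ 0ℓ
x ≈ℝ y = ∀ ε → 0ℚ ℚ.< ε →
  ∃[ N ] ∀ n → N ℕ.≤ n → ∣ seq x n ℚ.- seq y n ∣ ℚ.< ε

-- A termwise strict inequality would not respect _≈ℝ_; the gap has to be
-- bounded away from 0.
_<ℝ_ : Rel ℝ 0ℓ
x <ℝ y = ∃[ ε ] 0ℚ ℚ.< ε ×
  (∃[ N ] ∀ n → N ℕ.≤ n → seq x n ℚ.+ ε ℚ.< seq y n)

module _ where
  open ℚ.≤-Reasoning
  open CommutativeSemigroupProperties
    (CommutativeMonoid.commutativeSemigroup ℚ.+-0-commutativeMonoid) using (interchange)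

  abstract
    sum-difference : ∀ a b c d →
      (a ℚ.+ b) ℚ.- (c ℚ.+ d) ≡ (a ℚ.- c) ℚ.+ (b ℚ.- d)
    sum-difference a b c d = trans (cong ((a ℚ.+ b) ℚ.+_) (ℚ.neg-distrib-+ c d))
      (interchange a b (ℚ.- c) (ℚ.- d))

    subtract-add : ∀ a b → (a ℚ.- b) ℚ.+ b ≡ a
    subtract-add a b = trans (ℚ.+-assoc a (ℚ.- b) b)
      (trans (cong (a ℚ.+_) (ℚ.+-inverseˡ b)) (ℚ.+-identityʳ a))

    telescope : ∀ a b c → (a ℚ.- b) ℚ.+ (b ℚ.- c) ≡ a ℚ.- c
    telescope a b c = trans (sym (ℚ.+-assoc (a ℚ.- b) b (ℚ.- c)))
      (cong (ℚ._- c) (subtract-add a b))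

    *-distribˡ-- : ∀ a b c → a ℚ.* (b ℚ.- c) ≡ a ℚ.* b ℚ.- a ℚ.* c
    *-distribˡ-- a b c = trans (ℚ.*-distribˡ-+ a b (ℚ.- c))
      (cong (a ℚ.* b ℚ.+_) (sym (ℚ.neg-distribʳ-* a c)))

    product-difference : ∀ a b c d →
      a ℚ.* b ℚ.- c ℚ.* d ≡ a ℚ.* (b ℚ.- d) ℚ.+ d ℚ.* (a ℚ.- c)
    product-difference a b c d = sym (trans
      (cong₂ ℚ._+_ (*-distribˡ-- a b d)
        (trans (*-distribˡ-- d a c) (cong₂ ℚ._-_ (ℚ.*-comm d a) (ℚ.*-comm d c))))
      (telescope (a ℚ.* b) (a ℚ.* d) (c ℚ.* d)))

    const-cauchy : ∀ q → Cauchy (λ _ → q)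
    const-cauchy q ε 0<ε = 0 , λ _ _ _ _ → subst (λ r → ∣ r ∣ ℚ.< ε) (sym (ℚ.+-inverseʳ q)) 0<ε

    neg-cauchy : ∀ x → Cauchy x → Cauchy (λ n → ℚ.- x n)
    neg-cauchy x cx ε 0<ε with cx ε 0<ε
    ... | N , h = N , λ m n N≤m N≤n → subst (ℚ._< ε) (lemma (x m) (x n)) (h m n N≤m N≤n)
      where
      lemma : ∀ p q → ∣ p ℚ.- q ∣ ≡ ∣ (ℚ.- p) ℚ.- (ℚ.- q) ∣
      lemma p q = trans (sym (ℚ.∣-p∣≡∣p∣ (p ℚ.- q)))
        (cong ∣_∣ (ℚ.neg-distrib-+ p (ℚ.- q)))

    add-cauchy : ∀ x y → Cauchy x → Cauchy y → Cauchy (λ n → x n ℚ.+ y n)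
    add-cauchy x y cx cy ε 0<ε
      with cx (½ ℚ.* ε) 0<ε/2 | cy (½ ℚ.* ε) 0<ε/2
      where
      0<ε/2 : 0ℚ ℚ.< ½ ℚ.* ε
      0<ε/2 = subst (ℚ._< ½ ℚ.* ε) (ℚ.*-zeroʳ ½) (ℚ.*-monoʳ-<-pos ½ 0<ε)
    ... | N , h | M , k = N ⊔ M , λ m n l l′ → begin-strict
      ∣ (x m ℚ.+ y m) ℚ.- (x n ℚ.+ y n) ∣
        ≡⟨ cong ∣_∣ (sum-difference (x m) (y m) (x n) (y n)) ⟩
      ∣ (x m ℚ.- x n) ℚ.+ (y m ℚ.- y n) ∣
        ≤⟨ ℚ.∣p+q∣≤∣p∣+∣q∣ (x m ℚ.- x n) (y m ℚ.- y n) ⟩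
      ∣ x m ℚ.- x n ∣ ℚ.+ ∣ y m ℚ.- y n ∣
        <⟨ ℚ.+-mono-< (h m n (ℕ.m⊔n≤o⇒m≤o N M l) (ℕ.m⊔n≤o⇒m≤o N M l′))
                      (k m n (ℕ.m⊔n≤o⇒n≤o N M l) (ℕ.m⊔n≤o⇒n≤o N M l′)) ⟩
      ½ ℚ.* ε ℚ.+ ½ ℚ.* ε
        ≡⟨ sym (ℚ.*-distribʳ-+ ε ½ ½) ⟩
      1ℚ ℚ.* ε
        ≡⟨ ℚ.*-identityˡ ε ⟩
      ε ∎

    bounded : ∀ x → Cauchy x →
      ∃[ K ] ℚ.Positive K × (∃[ N ] ∀ n → N ℕ.≤ n → ∣ x n ∣ ℚ.≤ K)
    bounded x cx with cx 1ℚ (ℚ.positive⁻¹ 1ℚ)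
    ... | N , h = 1ℚ ℚ.+ ∣ x N ∣ , K>0 , N , λ n N≤n → begin
      ∣ x n ∣
        ≡⟨ cong ∣_∣ (sym (subtract-add (x n) (x N))) ⟩
      ∣ (x n ℚ.- x N) ℚ.+ x N ∣
        ≤⟨ ℚ.∣p+q∣≤∣p∣+∣q∣ (x n ℚ.- x N) (x N) ⟩
      ∣ x n ℚ.- x N ∣ ℚ.+ ∣ x N ∣
        ≤⟨ ℚ.+-monoˡ-≤ ∣ x N ∣ (ℚ.<⇒≤ (h n N N≤n ℕ.≤-refl)) ⟩
      1ℚ ℚ.+ ∣ x N ∣ ∎
      where
      K>0 : ℚ.Positive (1ℚ ℚ.+ ∣ x N ∣)
      K>0 = ℚ.positive (ℚ.+-mono-<-≤ (ℚ.positive⁻¹ 1ℚ) (ℚ.0≤∣p∣ (x N)))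

    mul-close : ∀ x y → Cauchy x → Cauchy y → ∀ ε → 0ℚ ℚ.< ε →
      ∀ K {{_ : ℚ.Positive K}} N₁ → (∀ n → N₁ ℕ.≤ n → ∣ x n ∣ ℚ.≤ K) →
      ∀ M {{_ : ℚ.Positive M}} N₂ → (∀ n → N₂ ℕ.≤ n → ∣ y n ∣ ℚ.≤ M) →
      ∃[ N ] ∀ m n → N ℕ.≤ m → N ℕ.≤ n → ∣ x m ℚ.* y m ℚ.- x n ℚ.* y n ∣ ℚ.< ε
    mul-close x y cx cy ε 0<ε K N₁ hK M N₂ hM = go (cx δ 0<δ) (cy δ 0<δ)
      where
      S : ℚ
      S = K ℚ.+ M
      instance
        S>0 : ℚ.Positive S
        S>0 = ℚ.pos+pos⇒pos K M
        S≠0 : ℚ.NonZero S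
        S≠0 = ℚ.pos⇒nonZero S
        1/S>0 : ℚ.Positive (ℚ.1/ S)
        1/S>0 = ℚ.1/pos⇒pos S
      δ : ℚ
      δ = ℚ.1/ S ℚ.* ε
      0<δ : 0ℚ ℚ.< δ
      0<δ = subst (ℚ._< δ) (ℚ.*-zeroʳ (ℚ.1/ S)) (ℚ.*-monoʳ-<-pos (ℚ.1/ S) 0<ε)

      product-bound : ∀ a b c → .{{_ : ℚ.Positive c}} →
        ∣ a ∣ ℚ.≤ c → ∣ b ∣ ℚ.< δ → ∣ a ℚ.* b ∣ ℚ.< c ℚ.* δ
      product-bound a b c a≤c b<δ = begin-strict
        ∣ a ℚ.* b ∣          ≡⟨ ℚ.∣p*q∣≡∣p∣*∣q∣ a b ⟩
        ∣ a ∣ ℚ.* ∣ b ∣      ≤⟨ ℚ.*-monoʳ-≤-nonNeg ∣ b ∣ {{ℚ.nonNegative (ℚ.0≤∣p∣ b)}} a≤c ⟩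
        c ℚ.* ∣ b ∣          <⟨ ℚ.*-monoʳ-<-pos c b<δ ⟩
        c ℚ.* δ              ∎

      go : ∃[ N ] (∀ m n → N ℕ.≤ m → N ℕ.≤ n → ∣ x m ℚ.- x n ∣ ℚ.< δ) →
           ∃[ N ] (∀ m n → N ℕ.≤ m → N ℕ.≤ n → ∣ y m ℚ.- y n ∣ ℚ.< δ) →
           ∃[ N ] (∀ m n → N ℕ.≤ m → N ℕ.≤ n → ∣ x m ℚ.* y m ℚ.- x n ℚ.* y n ∣ ℚ.< ε)
      go (N₃ , h) (N₄ , k) = (N₁ ⊔ N₂) ⊔ (N₃ ⊔ N₄) , λ m n l l′ →
        let l₁₂  = ℕ.m⊔n≤o⇒m≤o (N₁ ⊔ N₂) (N₃ ⊔ N₄) l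
            l₃₄  = ℕ.m⊔n≤o⇒n≤o (N₁ ⊔ N₂) (N₃ ⊔ N₄) l
            l₁₂′ = ℕ.m⊔n≤o⇒m≤o (N₁ ⊔ N₂) (N₃ ⊔ N₄) l′
            l₃₄′ = ℕ.m⊔n≤o⇒n≤o (N₁ ⊔ N₂) (N₃ ⊔ N₄) l′
        in begin-strict
        ∣ x m ℚ.* y m ℚ.- x n ℚ.* y n ∣
          ≡⟨ cong ∣_∣ (product-difference (x m) (y m) (x n) (y n)) ⟩
        ∣ x m ℚ.* (y m ℚ.- y n) ℚ.+ y n ℚ.* (x m ℚ.- x n) ∣
          ≤⟨ ℚ.∣p+q∣≤∣p∣+∣q∣ (x m ℚ.* (y m ℚ.- y n)) (y n ℚ.* (x m ℚ.- x n)) ⟩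
        ∣ x m ℚ.* (y m ℚ.- y n) ∣ ℚ.+ ∣ y n ℚ.* (x m ℚ.- x n) ∣
          <⟨ ℚ.+-mono-<
               (product-bound (x m) (y m ℚ.- y n) K (hK m (ℕ.m⊔n≤o⇒m≤o N₁ N₂ l₁₂))
                 (k m n (ℕ.m⊔n≤o⇒n≤o N₃ N₄ l₃₄) (ℕ.m⊔n≤o⇒n≤o N₃ N₄ l₃₄′)))
               (product-bound (y n) (x m ℚ.- x n) M (hM n (ℕ.m⊔n≤o⇒n≤o N₁ N₂ l₁₂′))
                 (h m n (ℕ.m⊔n≤o⇒m≤o N₃ N₄ l₃₄) (ℕ.m⊔n≤o⇒m≤o N₃ N₄ l₃₄′))) ⟩
        K ℚ.* δ ℚ.+ M ℚ.* δ
          ≡⟨ sym (ℚ.*-distribʳ-+ δ K M) ⟩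
        S ℚ.* (ℚ.1/ S ℚ.* ε)
          ≡⟨ sym (ℚ.*-assoc S (ℚ.1/ S) ε) ⟩
        (S ℚ.* ℚ.1/ S) ℚ.* ε
          ≡⟨ cong (ℚ._* ε) (ℚ.*-inverseʳ S) ⟩
        1ℚ ℚ.* ε
          ≡⟨ ℚ.*-identityˡ ε ⟩
        ε ∎

    mul-cauchy : ∀ x y → Cauchy x → Cauchy y → Cauchy (λ n → x n ℚ.* y n)
    mul-cauchy x y cx cy ε 0<ε =
      let K , K>0 , N₁ , hK = bounded x cx
          M , M>0 , N₂ , hM = bounded y cy
      in mul-close x y cx cy ε 0<ε K {{K>0}} N₁ hK M {{M>0}} N₂ hM

fromℚ : ℚ → ℝ
fromℚ q = mkℝ (λ _ → q) (const-cauchy q)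

0ℝ 1ℝ : ℝ
0ℝ = fromℚ 0ℚ
1ℝ = fromℚ 1ℚ

ℝ-rawRing : RawRing 0ℓ 0ℓ
ℝ-rawRing = record
  { Carrier = ℝ
  ; _≈_     = _≈ℝ_
  ; _+_     = λ x y → mkℝ (λ n → seq x n ℚ.+ seq y n) (add-cauchy (seq x) (seq y) (cauchy x) (cauchy y))
  ; _*_     = λ x y → mkℝ (λ n → seq x n ℚ.* seq y n) (mul-cauchy (seq x) (seq y) (cauchy x) (cauchy y))
  ; -_      = λ x → mkℝ (λ n → ℚ.- seq x n) (neg-cauchy (seq x) (cauchy x))
  ; 0#      = 0ℝ
  ; 1#      = 1ℝ
  }

module Polynomial {c ℓ} (R : RawRing c ℓ) where
  open RawRing R

  -- Coefficients, constant term first; trailing zeros are allowed and are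
  -- ignored by _≈ₚ_.
  Poly : Set c
  Poly = List Carrier

  coeff : Poly → ℕ → Carrier
  coeff []      _       = 0#
  coeff (a ∷ p) zero    = a
  coeff (a ∷ p) (suc k) = coeff p k

  infix  4 _≈ₚ_
  infixl 6 _+ₚ_
  infixl 7 _*ₚ_

  _≈ₚ_ : Rel Poly ℓ
  p ≈ₚ q = ∀ k → coeff p k ≈ coeff q k

  _+ₚ_ : Poly → Poly → Poly
  []      +ₚ q       = q
  (a ∷ p) +ₚ []      = a ∷ p
  (a ∷ p) +ₚ (b ∷ q) = (a + b) ∷ (p +ₚ q)

  _*ₚ_ : Poly → Poly → Poly
  []      *ₚ q = []
  (a ∷ p) *ₚ q = map (a *_) q +ₚ (0# ∷ (p *ₚ q))

  const : Carrier → Poly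
  const a = a ∷ []

  X : Poly
  X = 0# ∷ 1# ∷ []

  eval : Poly → Carrier → Carrier
  eval p x = foldr (λ a r → a + x * r) 0# p

  poly-rawRing : RawRing c ℓ
  poly-rawRing = record
    { Carrier = Poly
    ; _≈_     = _≈ₚ_
    ; _+_     = _+ₚ_
    ; _*_     = _*ₚ_
    ; -_      = map -_
    ; 0#      = []
    ; 1#      = const 1#
    }

Matrix : ∀ {a} → Set a → ℕ → Set a
Matrix A N = Fin N → Fin N → A

-- A(j)
deleteRowCol : ∀ {a} {A : Set a} {N} → Matrix A N → Fin N → Matrix A (pred N)
deleteRowCol {N = suc n} M j r s = M (punchIn j r) (punchIn j s)

module Determinant {c ℓ} (R : RawRing c ℓ) where
  open RawRing R
  open RawSemiringOps rawSemiring using (sum; _^_)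

  -- Laplace expansion along the first row.
  det : ∀ {N} → Matrix Carrier N → Carrier
  det {zero}  M = 1#
  det {suc n} M = sum λ j →
    (- 1#) ^ toℕ j * (M zero j * det (λ r s → M (suc r) (punchIn j s)))

module Eigenvalue {c ℓ} (R : RawRing c ℓ) where
  open RawRing R
  open Polynomial R
  open RawRing poly-rawRing using () renaming (-_ to -ₚ_; 0# to 0ₚ)
  open RawSemiringOps (RawRing.rawSemiring poly-rawRing) using (_^_)
  open Determinant poly-rawRing using (det)

  -- det (x I - M)
  charPoly : ∀ {N} → Matrix Carrier N → Poly
  charPoly M = det λ i j → (if does (i ≟ j) then X else 0ₚ) +ₚ (-ₚ const (M i j))

  -- The multiplicity of μ as a root of the characteristic polynomial is k
  -- (k = 0 when μ is not an eigenvalue).  A relation rather than a function,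
  -- since equality of reals is not decidable; k is determined by M and μ.
  AlgebraicMultiplicity : ∀ {N} → Matrix Carrier N → Carrier → ℕ → Set (c L.⊔ ℓ)
  AlgebraicMultiplicity M μ k = Σ[ g ∈ Poly ]
    charPoly M ≈ₚ (X +ₚ (-ₚ const μ)) ^ k *ₚ g × ¬ (eval g μ ≈ 0#)

open Eigenvalue ℝ-rawRing public using (charPoly; AlgebraicMultiplicity)

data SignEntry : Set where
  pos neg zer : SignEntry

SignPattern : ℕ → Set
SignPattern = Matrix SignEntry

SymmetricPattern : ∀ {N} → SignPattern N → Set
SymmetricPattern P = ∀ i j → P i j ≡ P j i

NonnegativePattern : ∀ {N} → SignPattern N → Set
NonnegativePattern P = ∀ i j → P i j ≡ pos ⊎ P i j ≡ zer

ZeroDiagonal : ∀ {N} → SignPattern N → Set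
ZeroDiagonal P = ∀ i → P i i ≡ zer

HasSign : ℝ → SignEntry → Set
HasSign x pos = 0ℝ <ℝ x
HasSign x neg = x <ℝ 0ℝ
HasSign x zer = x ≈ℝ 0ℝ

-- A ∈ Q_SYM(P)
Q-SYM : ∀ {N} → SignPattern N → Matrix ℝ N → Set
Q-SYM P A = (∀ i j → A i j ≈ℝ A j i) × (∀ i j → HasSign (A i j) (P i j))

PVertex : ∀ {N} → Matrix ℝ N → Fin N → Set
PVertex A j = ∃[ m ] ∃[ k ]
  AlgebraicMultiplicity (deleteRowCol A j) 0ℝ m ×
  AlgebraicMultiplicity A 0ℝ k ×
  ℤ.+ m ℤ.- ℤ.+ k ≡ 1ℤ

RequiresFullPVertices : ∀ {N} → SignPattern N → Set
RequiresFullPVertices P = ∀ A → Q-SYM P A → ∀ j → PVertex A j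

-- Undirected graphs; loops are not excluded, since a sign pattern may have
-- nonzero diagonal entries.
record Graph : Set₁ where
  field
    Vertex : Set
    _~_    : Rel Vertex 0ℓ
    ~-sym  : Symmetric _~_

record _≅_ (G H : Graph) : Set where
  private
    module G = Graph G
    module H = Graph H
  field
    vertices  : G.Vertex ↔ H.Vertex
    adjacency : ∀ x y → x G.~ y ⇔ Inverse.to vertices x H.~ Inverse.to vertices y

underlyingGraph : ∀ {N} (P : SignPattern N) → SymmetricPattern P → Graph
underlyingGraph {N} P P-sym = record
  { Vertex = Fin N
  ; _~_    = λ i j → P i j ≢ zer
  ; ~-sym  = λ {i} {j} Pij≢0 Pji≡0 → Pij≢0 (trans (P-sym i j) Pji≡0)
  }

-- The cyclic successor relation on Fin a, i.e. j ≡ i + 1 (mod a).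
CyclicSuc : ∀ {a} → Rel (Fin a) 0ℓ
CyclicSuc {a} i j = toℕ j ≡ suc (toℕ i) ⊎ (suc (toℕ i) ≡ a × toℕ j ≡ 0)

-- The vertices u₁,…,uₐ and w₁,…,w_b of the two cycles and the internal
-- vertices v₁,…,vₛ of the joining path, all indexed from 0.
data DumbbellVertex (a b s : ℕ) : Set where
  u : Fin a → DumbbellVertex a b s
  w : Fin b → DumbbellVertex a b s
  v : Fin s → DumbbellVertex a b s

module _ {a b s : ℕ} where

  -- PathAt k x: x is the k-th vertex of the path u₁, v₁, …, vₛ, w₁,
  -- counting from 0.
  data PathAt : ℕ → DumbbellVertex a b s → Set where
    start    : ∀ {i} → toℕ i ≡ 0 → PathAt 0 (u i)
    internal : ∀ {i} → PathAt (suc (toℕ i)) (v i)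
    end      : ∀ {i} → toℕ i ≡ 0 → PathAt (suc s) (w i)

  data DumbbellEdge : Rel (DumbbellVertex a b s) 0ℓ where
    cycleᵤ : ∀ {i j} → CyclicSuc i j → DumbbellEdge (u i) (u j)
    cycle𝓌 : ∀ {i j} → CyclicSuc i j → DumbbellEdge (w i) (w j)
    path   : ∀ {k x y} → PathAt k x → PathAt (suc k) y → DumbbellEdge x y

-- The dumbbell graph D_{a,b,c}, for a, b ≥ 3 and c ≥ -1, is dumbbell a b (c + 1):
-- the third argument is the number of internal vertices of the joining path,
-- so that it can be a natural number.
dumbbell : (a b s : ℕ) → Graph
dumbbell a b s = record
  { Vertex = DumbbellVertex a b s
  ; _~_    = SymClosure DumbbellEdge
  ; ~-sym  = symmetric DumbbellEdge
  }

{-# OPTIONS --safe #-}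

-- Every A in the class is nonsingular: along the 2p + 1 vertices at even
-- distance on a cycle of length 4p + 2, consecutive coordinates of a kernel
-- vector have opposite signs, and 2p + 1 is odd, so they vanish; zeros then
-- spread along the path, which has an even number of internal vertices, and
-- back into the remaining vertices of the cycles.  Now delete row and column j.
-- The rows of A other than j annihilate some z ≠ 0, and bipartiteness forces
-- z_j = 0, so z gives a kernel vector of M = A(j).  Replacing column k of xI - M
-- by (xI - M) z = x z shows z_k det (xI - M) = x det (xI - M)[k ← z], hence 0 is
-- a root of the characteristic polynomial, and z_k times its linear coefficient
-- is det (-M)[k ← z].  Since M is symmetric and A injective, that bordered
-- matrix is injective too.  For Cauchy reals x ≈ 0 is stable under double
-- negation, which makes classical linear algebra available for the negated
-- conclusions needed here.
module Submission where

open import Defs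
open import Algebra.Bundles using (AbelianGroup; CommutativeRing)
open import Algebra.Bundles.Raw using (RawRing)
import Algebra.Construct.DirectProduct as DirectProduct
import Algebra.Definitions.RawSemiring as RawSemiringOps
import Algebra.Properties.Ring as RingProperties
import Algebra.Properties.Semiring.Sum as SumProperties
open import Data.Bool.Base using (Bool; true; false; not; if_then_else_)
import Data.Bool.Properties as Bool
open import Data.Empty using (⊥)
open import Data.Fin.Base using (Fin; zero; suc; toℕ; fromℕ<; inject₁; punchIn; punchOut)
open import Data.Fin.Properties using (_≟_; punchInᵢ≢i; punchIn-punchOut; punchIn-injective;
  toℕ-inject₁; toℕ-injective; toℕ-fromℕ<; toℕ<n)
open import Data.List.Base using ([]; _∷_; map; drop)
open import Data.Nat.Base as ℕ using (ℕ; zero; suc; _<_; _≤_; _⊔_; _∸_; z≤n; s≤s; s<s)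
open import Data.Nat.DivMod using (_%_; _/_; _mod_; m≡m%n+[m/n]*n; [m+kn]%n≡m%n; [m+n]%n≡m%n;
  m<n⇒m%n≡m; m%n<n; n%n≡0)
import Data.Nat.Properties as ℕ
import Data.Nat.Solver as ℕSolver
open import Data.Product.Base using (∃-syntax; _×_; _,_; proj₁; proj₂)
open import Data.Rational.Base as ℚ using (ℚ; 0ℚ; 1ℚ; ½; ∣_∣)
import Data.Rational.Properties as ℚ
open import Data.Sum.Base using (_⊎_; inj₁; inj₂)
open import Data.Vec.Functional using (updateAt; insertAt)
open import Data.Vec.Functional.Properties using (updateAt-updates; updateAt-minimal;
  updateAt-commutes; insertAt-lookup; insertAt-punchIn)
open import Function.Base using (_∘_)
open import Function.Bundles using (Inverse; Equivalence)
open import Level using (0ℓ) renaming (_⊔_ to _⊔ᴸ_; suc to lsuc)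
open import Relation.Binary.Construct.Closure.Symmetric using (fwd; bwd)
open import Relation.Binary.Definitions using (tri<; tri≈; tri>)
open import Relation.Binary.PropositionalEquality as ≡ using (_≡_; _≢_)
import Relation.Binary.Reasoning.Setoid as SetoidReasoning
open import Relation.Nullary using (¬_; yes; no; contradiction; does)

-- Determinants: linearity, alternation and Cramer's rule in the columns

-- The multiplicities to be shown are 1 for the deleted matrix and 0 for A, so of each
-- characteristic polynomial only the coefficients of 1 and x matter. The given determinant is taken
-- over coefficient lists, for which no ring laws are at hand; it is therefore carried to the dual
-- numbers, a commutative ring in which column expansions and Cramer's rule are available. The
-- obstacle behind the form of the linear algebra is that a real cannot be compared with 0:
-- elimination finds no pivot, and a number merely known to be nonzero has no inverse to multiply
-- by. Hence relations are cross-multiplied instead of solved, a nonzero kernel vector is only ever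
-- assumed while deriving an absurdity, and opposite signs are expressed by an equation with
-- positive coefficients. A kernel of dimension 1 would not yet make 0 a simple root. That also
-- depends on the kernel vector not being orthogonal to itself, and this is where sums of squares of
-- reals enter.

punchIn-adjacent : ∀ {n} (k : Fin (suc (suc n))) (i : Fin (suc n)) → k ≢ inject₁ i → k ≢ suc i →
  ∃[ i′ ] punchIn k (inject₁ i′) ≡ inject₁ i × punchIn k (suc i′) ≡ suc i
punchIn-adjacent zero zero k≢i _ = contradiction ≡.refl k≢i
punchIn-adjacent zero (suc i) _ _ = i , ≡.refl , ≡.refl
punchIn-adjacent (suc zero) zero _ k≢i+1 = contradiction ≡.refl k≢i+1
punchIn-adjacent {suc n} (suc (suc k)) zero _ _ = zero , ≡.refl , ≡.refl
punchIn-adjacent {suc n} (suc k) (suc i) k≢i k≢i+1 =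
  let i′ , p , q = punchIn-adjacent k i (k≢i ∘ ≡.cong suc) (k≢i+1 ∘ ≡.cong suc)
  in suc i′ , ≡.cong suc p , ≡.cong suc q

-- Deleting one or the other of two adjacent indices keeps the same indices in the same order,
-- except at one place, where each deletion keeps the index that the other removes. Two equal
-- adjacent columns therefore have equal minors.
punchIn-inject₁-suc : ∀ {n} (i s : Fin n) →
  punchIn (inject₁ i) s ≡ punchIn (suc i) s ⊎
  (punchIn (inject₁ i) s ≡ suc i × punchIn (suc i) s ≡ inject₁ i)
punchIn-inject₁-suc zero zero = inj₂ (≡.refl , ≡.refl)
punchIn-inject₁-suc zero (suc s) = inj₁ ≡.refl
punchIn-inject₁-suc (suc i) zero = inj₁ ≡.refl
punchIn-inject₁-suc (suc i) (suc s) with punchIn-inject₁-suc i s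
... | inj₁ p = inj₁ (≡.cong suc p)
... | inj₂ (p , q) = inj₂ (≡.cong suc p , ≡.cong suc q)

module FiniteSums {c ℓ} (R : CommutativeRing c ℓ) where
  open CommutativeRing R hiding (zero)
  open RingProperties ring using (-1*x≈-x; -‿distribˡ-*)
  open SumProperties semiring
  open SetoidReasoning setoid

  *-≈0ʳ : ∀ x {y} → y ≈ 0# → x * y ≈ 0#
  *-≈0ʳ x y≈0 = trans (*-congˡ y≈0) (zeroʳ x)

  *-≈0ˡ : ∀ {x} y → x ≈ 0# → x * y ≈ 0#
  *-≈0ˡ y x≈0 = trans (*-congʳ x≈0) (zeroˡ y)

  sum-zero : ∀ {n} (t : Fin n → Carrier) → (∀ i → t i ≈ 0#) → sum t ≈ 0#
  sum-zero {n} t t≈0 = trans (sum-cong-≋ t≈0) (sum-replicate-zero n)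

  sum-single : ∀ {n} (t : Fin n → Carrier) i → (∀ k → k ≢ i → t k ≈ 0#) → sum t ≈ t i
  sum-single {suc n} t i t≈0 = begin
    sum t                           ≈⟨ sum-remove {i = i} t ⟩
    t i + sum (t ∘ punchIn i)       ≈⟨ +-congˡ (sum-zero _ (λ k → t≈0 _ (punchInᵢ≢i i k))) ⟩
    t i + 0#                        ≈⟨ +-identityʳ _ ⟩
    t i                             ∎

  sum-pair : ∀ {n} (t : Fin n → Carrier) {i j} → i ≢ j →
    (∀ k → k ≢ i → k ≢ j → t k ≈ 0#) → sum t ≈ t i + t j
  sum-pair {suc n} t {i} {j} i≢j t≈0 = begin
    sum t                           ≈⟨ sum-remove {i = i} t ⟩
    t i + sum (t ∘ punchIn i)       ≈⟨ +-congˡ (sum-single _ (punchOut i≢j) λ k k≢ →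
                                        t≈0 _ (punchInᵢ≢i i k) λ e →
                                        k≢ (punchIn-injective i _ _ (≡.trans e (≡.sym (punchIn-punchOut i≢j))))) ⟩
    t i + t (punchIn i (punchOut i≢j)) ≡⟨ ≡.cong (λ k → t i + t k) (punchIn-punchOut i≢j) ⟩
    t i + t j                       ∎

  sum≈0⇒single≈0 : ∀ {n} (t : Fin n → Carrier) i → (∀ k → k ≢ i → t k ≈ 0#) → sum t ≈ 0# → t i ≈ 0#
  sum≈0⇒single≈0 t i t≈0 = trans (sym (sum-single t i t≈0))

  sum≈0⇒pair≈0 : ∀ {n} (t : Fin n → Carrier) {i j} → i ≢ j →
    (∀ k → k ≢ i → k ≢ j → t k ≈ 0#) → sum t ≈ 0# → t i + t j ≈ 0#
  sum≈0⇒pair≈0 t i≢j t≈0 = trans (sym (sum-pair t i≢j t≈0))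

  sum-neg-* : ∀ {n} (x y : Fin n → Carrier) → sum (λ i → - x i * y i) ≈ - sum (λ i → x i * y i)
  sum-neg-* x y = begin
    sum (λ i → - x i * y i)
      ≈⟨ sum-cong-≋ (λ i → trans (sym (-‿distribˡ-* (x i) (y i))) (sym (-1*x≈-x (x i * y i)))) ⟩
    sum (λ i → - 1# * (x i * y i))
      ≈⟨ *-distribˡ-sum (- 1#) (λ i → x i * y i) ⟨
    - 1# * sum (λ i → x i * y i)
      ≈⟨ -1*x≈-x _ ⟩
    - sum (λ i → x i * y i) ∎

module ColumnOperations {c ℓ} (R : CommutativeRing c ℓ) where
  open CommutativeRing R hiding (zero)
  open RingProperties ring using (-1*x≈-x)
  open SumProperties semiring
  open FiniteSums R
  open Determinant rawRing using (det)
  open import Algebra.Definitions.RawSemiring (RawRing.rawSemiring rawRing) using (_^_)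
  open import Algebra.Solver.Ring.NaturalCoefficients.Default commutativeSemiring
    using (solve; _:=_; _:+_; _:*_)
  open SetoidReasoning setoid

  Mat : ℕ → Set c
  Mat = Matrix Carrier

  minor : ∀ {n} → Mat (suc n) → Fin (suc n) → Mat n
  minor M j r s = M (suc r) (punchIn j s)

  laplaceTerm : ∀ {n} → Mat (suc n) → Fin (suc n) → Carrier
  laplaceTerm M j = (- 1#) ^ toℕ j * (M zero j * det (minor M j))

  det-cong : ∀ {n} {M M′ : Mat n} → (∀ r j → M r j ≈ M′ r j) → det M ≈ det M′
  det-cong {zero} _ = refl
  det-cong {suc n} M≈M′ = sum-cong-≋ λ j →
    *-congˡ {(- 1#) ^ toℕ j} (*-cong (M≈M′ zero j) (det-cong λ r s → M≈M′ (suc r) (punchIn j s)))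

  -- In the term of column k the entry carries the linearity and the three minors agree; in any
  -- other term the minor carries it, with k reindexed by `punchOut`. Asking for three matrices that
  -- agree off column k gives the hypotheses a form that passes to minors unchanged.
  det-linear : ∀ {n} {M M₁ M₂ : Mat n} k a b →
    (∀ r j → j ≢ k → M r j ≈ M₁ r j) → (∀ r j → j ≢ k → M r j ≈ M₂ r j) →
    (∀ r → M r k ≈ a * M₁ r k + b * M₂ r k) →
    det M ≈ a * det M₁ + b * det M₂
  det-linear {suc n} {M} {M₁} {M₂} k a b M≈M₁ M≈M₂ Mk = begin
    det M
      ≈⟨ sum-cong-≋ term ⟩
    sum (λ j → a * t M₁ j + b * t M₂ j)
      ≈⟨ ∑-distrib-+ (λ j → a * t M₁ j) (λ j → b * t M₂ j) ⟩
    sum (λ j → a * t M₁ j) + sum (λ j → b * t M₂ j)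
      ≈⟨ +-cong (*-distribˡ-sum a (t M₁)) (*-distribˡ-sum b (t M₂)) ⟨
    a * det M₁ + b * det M₂ ∎
    where
    t : Mat (suc n) → Fin (suc n) → Carrier
    t = laplaceTerm

    term : ∀ j → t M j ≈ a * t M₁ j + b * t M₂ j
    term j with j ≟ k
    ... | yes ≡.refl = begin
      σ * (M zero j * det (minor M j))
        ≈⟨ *-congˡ (*-congʳ (Mk zero)) ⟩
      σ * ((a * M₁ zero j + b * M₂ zero j) * det (minor M j))
        ≈⟨ solve 6 (λ s a x b y d → s :* ((a :* x :+ b :* y) :* d) := a :* (s :* (x :* d)) :+ b :* (s :* (y :* d)))
             refl σ a (M₁ zero j) b (M₂ zero j) (det (minor M j)) ⟩
      a * (σ * (M₁ zero j * det (minor M j))) + b * (σ * (M₂ zero j * det (minor M j)))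
        ≈⟨ +-cong
             (*-congˡ (*-congˡ (*-congˡ (det-cong λ r s → M≈M₁ (suc r) _ (punchInᵢ≢i j s)))))
             (*-congˡ (*-congˡ (*-congˡ (det-cong λ r s → M≈M₂ (suc r) _ (punchInᵢ≢i j s))))) ⟩
      a * t M₁ j + b * t M₂ j ∎
      where
      σ : Carrier
      σ = (- 1#) ^ toℕ j
    ... | no j≢k = begin
      σ * (M zero j * det (minor M j))
        ≈⟨ *-congˡ (*-congˡ (det-linear (punchOut j≢k) a b
             (λ r s s≢ → M≈M₁ (suc r) _ (s≢ ∘ unpunch))
             (λ r s s≢ → M≈M₂ (suc r) _ (s≢ ∘ unpunch))
             λ r → ≡.subst (λ i → M (suc r) i ≈ a * M₁ (suc r) i + b * M₂ (suc r) i)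
                     (≡.sym (punchIn-punchOut j≢k)) (Mk (suc r)))) ⟩
      σ * (M zero j * (a * det (minor M₁ j) + b * det (minor M₂ j)))
        ≈⟨ solve 6 (λ s m a x b y → s :* (m :* (a :* x :+ b :* y)) := a :* (s :* (m :* x)) :+ b :* (s :* (m :* y)))
             refl σ (M zero j) a (det (minor M₁ j)) b (det (minor M₂ j)) ⟩
      a * (σ * (M zero j * det (minor M₁ j))) + b * (σ * (M zero j * det (minor M₂ j)))
        ≈⟨ +-cong (*-congˡ (*-congˡ (*-congʳ (M≈M₁ zero j j≢k)))) (*-congˡ (*-congˡ (*-congʳ (M≈M₂ zero j j≢k)))) ⟩
      a * t M₁ j + b * t M₂ j ∎
      where
      σ : Carrier
      σ = (- 1#) ^ toℕ j
      unpunch : ∀ {s} → punchIn j s ≡ k → s ≡ punchOut j≢k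
      unpunch e = punchIn-injective j _ _ (≡.trans e (≡.sym (punchIn-punchOut j≢k)))

  x+[-1*x]≈0 : ∀ x → x + - 1# * x ≈ 0#
  x+[-1*x]≈0 x = trans (+-congˡ (-1*x≈-x x)) (-‿inverseʳ x)

  -- Only the terms of the two equal columns survive. Their entries and minors agree and their signs
  -- are opposite.
  det-adjacent : ∀ {n} (M : Mat (suc n)) (i : Fin n) →
    (∀ r → M r (inject₁ i) ≈ M r (suc i)) → det M ≈ 0#
  det-adjacent {suc n} M i eq = begin
    det M
      ≈⟨ sum-pair (laplaceTerm M) inject₁≢suc (λ k k≢i k≢i+1 →
           *-≈0ʳ _ (*-≈0ʳ _ (minor≈0 k k≢i k≢i+1))) ⟩
    (- 1#) ^ toℕ (inject₁ i) * (M zero (inject₁ i) * det (minor M (inject₁ i)))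
      + - 1# * σ * (M zero (suc i) * det (minor M (suc i)))
      ≈⟨ +-cong (*-cong (reflexive (≡.cong ((- 1#) ^_) (toℕ-inject₁ i)))
                        (*-cong (eq zero) (det-cong λ r s → same (suc r) s)))
                (*-assoc _ _ _) ⟩
    σ * (M zero (suc i) * det (minor M (suc i)))
      + - 1# * (σ * (M zero (suc i) * det (minor M (suc i))))
      ≈⟨ x+[-1*x]≈0 _ ⟩
    0# ∎
    where
    σ : Carrier
    σ = (- 1#) ^ toℕ i
    inject₁≢suc : inject₁ i ≢ suc i
    inject₁≢suc e = ℕ.1+n≢n (≡.sym (≡.trans (≡.sym (toℕ-inject₁ i)) (≡.cong toℕ e)))
    -- A minor that keeps both columns keeps them adjacent, so the induction on the size applies to
    -- it.
    minor≈0 : ∀ k → k ≢ inject₁ i → k ≢ suc i → det (minor M k) ≈ 0#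
    minor≈0 k k≢i k≢i+1 =
      let i′ , p , q = punchIn-adjacent k i k≢i k≢i+1
      in det-adjacent (minor M k) i′ λ r →
           trans (reflexive (≡.cong (M (suc r)) p))
             (trans (eq (suc r)) (reflexive (≡.cong (M (suc r)) (≡.sym q))))
    same : ∀ r s → M r (punchIn (inject₁ i) s) ≈ M r (punchIn (suc i) s)
    same r s with punchIn-inject₁-suc i s
    ... | inj₁ p = reflexive (≡.cong (M r) p)
    ... | inj₂ (p , q) = trans (reflexive (≡.cong (M r) p))
      (trans (sym (eq r)) (reflexive (≡.cong (M r) (≡.sym q))))

  replaceCol : ∀ {n} → Mat n → Fin n → (Fin n → Carrier) → Mat n
  replaceCol M k x r = updateAt (M r) k λ _ → x r

  replaceCol-same : ∀ {n} (M : Mat n) k x r → replaceCol M k x r k ≈ x r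
  replaceCol-same M k x r = reflexive (updateAt-updates k (M r))

  replaceCol-other : ∀ {n} (M : Mat n) k x r {j} → j ≢ k → replaceCol M k x r j ≈ M r j
  replaceCol-other M k x r {j} j≢k = reflexive (updateAt-minimal j k (M r) j≢k)

  replaceCol-cong : ∀ {n} {M M′ : Mat n} k {x y} → (∀ r j → M r j ≈ M′ r j) → (∀ r → x r ≈ y r) →
    ∀ r j → replaceCol M k x r j ≈ replaceCol M′ k y r j
  replaceCol-cong {M = M} {M′} k {x} {y} M≈M′ x≈y r j with j ≟ k
  ... | yes ≡.refl = trans (replaceCol-same M k x r) (trans (x≈y r) (sym (replaceCol-same M′ k y r)))
  ... | no j≢k = trans (replaceCol-other M k x r j≢k) (trans (M≈M′ r j) (sym (replaceCol-other M′ k y r j≢k)))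

  replaceCol-unique : ∀ {n} {M M′ : Mat n} k {x} → (∀ r j → j ≢ k → M r j ≈ M′ r j) →
    (∀ r → x r ≈ M′ r k) → ∀ r j → replaceCol M k x r j ≈ M′ r j
  replaceCol-unique {M = M} k {x} M≈M′ x≈M′k r j with j ≟ k
  ... | yes ≡.refl = trans (replaceCol-same M k x r) (x≈M′k r)
  ... | no j≢k = trans (replaceCol-other M k x r j≢k) (M≈M′ r j j≢k)

  det-replaceCol-linear : ∀ {n} (M : Mat n) k a b (x y : Fin n → Carrier) →
    det (replaceCol M k λ r → a * x r + b * y r)
      ≈ a * det (replaceCol M k x) + b * det (replaceCol M k y)
  det-replaceCol-linear M k a b x y = det-linear k a b
    (λ r j j≢k → trans (replaceCol-other M k (λ r → a * x r + b * y r) r j≢k) (sym (replaceCol-other M k x r j≢k)))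
    (λ r j j≢k → trans (replaceCol-other M k (λ r → a * x r + b * y r) r j≢k) (sym (replaceCol-other M k y r j≢k)))
    (λ r → trans (replaceCol-same M k (λ r → a * x r + b * y r) r) (sym
      (+-cong (*-congˡ (replaceCol-same M k x r)) (*-congˡ (replaceCol-same M k y r)))))

  det-replaceCol-+ : ∀ {n} (M : Mat n) k (x y : Fin n → Carrier) →
    det (replaceCol M k λ r → x r + y r) ≈ det (replaceCol M k x) + det (replaceCol M k y)
  det-replaceCol-+ M k x y = begin
    det (replaceCol M k λ r → x r + y r)
      ≈⟨ det-cong (replaceCol-cong k (λ _ _ → refl) λ r → sym (+-cong (*-identityˡ _) (*-identityˡ _))) ⟩
    det (replaceCol M k λ r → 1# * x r + 1# * y r)
      ≈⟨ det-replaceCol-linear M k 1# 1# x y ⟩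
    1# * det (replaceCol M k x) + 1# * det (replaceCol M k y)
      ≈⟨ +-cong (*-identityˡ _) (*-identityˡ _) ⟩
    det (replaceCol M k x) + det (replaceCol M k y) ∎

  det-replaceCol-* : ∀ {n} (M : Mat n) k a (x : Fin n → Carrier) →
    det (replaceCol M k λ r → a * x r) ≈ a * det (replaceCol M k x)
  det-replaceCol-* M k a x = begin
    det (replaceCol M k λ r → a * x r)
      ≈⟨ det-cong (replaceCol-cong k (λ _ _ → refl) λ r → sym (trans (+-congˡ (zeroˡ _)) (+-identityʳ _))) ⟩
    det (replaceCol M k λ r → a * x r + 0# * x r)
      ≈⟨ det-replaceCol-linear M k a 0# x x ⟩
    a * det (replaceCol M k x) + 0# * det (replaceCol M k x)
      ≈⟨ trans (+-congˡ (zeroˡ _)) (+-identityʳ _) ⟩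
    a * det (replaceCol M k x) ∎

  det-replaceCol-sum : ∀ {n m} (M : Mat n) k (x : Fin m → Fin n → Carrier) →
    det (replaceCol M k λ r → sum λ i → x i r) ≈ sum λ i → det (replaceCol M k (x i))
  det-replaceCol-sum {m = zero} M k x = begin
    det (replaceCol M k λ r → 0#)
      ≈⟨ det-cong (replaceCol-cong k (λ _ _ → refl) λ r → sym (zeroˡ 0#)) ⟩
    det (replaceCol M k λ r → 0# * 0#)
      ≈⟨ det-replaceCol-* M k 0# (λ _ → 0#) ⟩
    0# * det (replaceCol M k λ r → 0#)
      ≈⟨ zeroˡ _ ⟩
    0# ∎
  det-replaceCol-sum {m = suc m} M k x =
    trans (det-replaceCol-+ M k (x zero) _) (+-congˡ (det-replaceCol-sum M k (x ∘ suc)))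

  -- Expand the determinant with M_a + M_b in both columns a and b.
  det-alternating-step : ∀ {n} (M : Mat n) {i a b} → i ≢ a → i ≢ b → a ≢ b →
    (∀ M′ → (∀ r → M′ r a ≈ M′ r b) → det M′ ≈ 0#) →
    (∀ M′ → (∀ r → M′ r i ≈ M′ r a) → det M′ ≈ 0#) →
    (∀ r → M r i ≈ M r b) → det M ≈ 0#
  det-alternating-step {n} M {i} {a} {b} i≢a i≢b a≢b alt-ab alt-ia eq = begin
    det M
      ≈⟨ det-cong (replaceCol-unique {M′ = M} b (replaceCol-unique′ a) λ _ → refl) ⟨
    F y x
      ≈⟨ trans (+-congʳ (F-diag y)) (+-identityˡ _) ⟨
    F y y + F y x
      ≈⟨ trans (+-congˡ (trans (+-cong F-xy≈0 (F-diag x)) (+-identityˡ _))) (+-identityʳ _) ⟨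
    (F y y + F y x) + (F x y + F x x)
      ≈⟨ +-cong (det-replaceCol-+ _ b y x) (det-replaceCol-+ _ b y x) ⟨
    F y (λ r → y r + x r) + F x (λ r → y r + x r)
      ≈⟨ F-+ˡ (λ r → y r + x r) ⟨
    F (λ r → y r + x r) (λ r → y r + x r)
      ≈⟨ F-diag _ ⟩
    0# ∎
    where
    x y : Fin n → Carrier
    x r = M r b
    y r = M r a
    F : (Fin n → Carrier) → (Fin n → Carrier) → Carrier
    F f g = det (replaceCol (replaceCol M a f) b g)
    F-a : ∀ f g r → replaceCol (replaceCol M a f) b g r a ≈ f r
    F-a f g r = trans (replaceCol-other (replaceCol M a f) b g r a≢b) (replaceCol-same M a f r)
    F-diag : ∀ f → F f f ≈ 0#
    F-diag f = alt-ab _ λ r →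
      trans (F-a f f r) (sym (replaceCol-same (replaceCol M a f) b f r))
    commute : ∀ f g r s → replaceCol (replaceCol M a f) b g r s ≈ replaceCol (replaceCol M b g) a f r s
    commute f g r s = reflexive (updateAt-commutes b a (a≢b ∘ ≡.sym) (M r) s)
    replaceCol-unique′ : ∀ k r j → j ≢ b → replaceCol M k (λ r → M r k) r j ≈ M r j
    replaceCol-unique′ k r j _ = replaceCol-unique {M′ = M} k (λ _ _ _ → refl) (λ _ → refl) r j
    F-+ˡ : ∀ g → F (λ r → y r + x r) g ≈ F y g + F x g
    F-+ˡ g = begin
      F (λ r → y r + x r) g
        ≈⟨ det-cong (commute _ g) ⟩
      det (replaceCol (replaceCol M b g) a λ r → y r + x r)
        ≈⟨ det-replaceCol-+ _ a y x ⟩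
      det (replaceCol (replaceCol M b g) a y) + det (replaceCol (replaceCol M b g) a x)
        ≈⟨ +-cong (det-cong (commute y g)) (det-cong (commute x g)) ⟨
      F y g + F x g ∎
    F-xy≈0 : F x y ≈ 0#
    F-xy≈0 = alt-ia _ λ r → trans
      (trans (replaceCol-other (replaceCol M a x) b y r i≢b) (trans (replaceCol-other M a x r i≢a) (eq r)))
      (sym (F-a x y r))

  -- Induction on the larger index: column `inject₁ j` is adjacent to column `suc j` and, with i, is
  -- covered by the induction hypothesis, which are the two inputs of `det-alternating-step`. The
  -- index m is a separate argument to make the recursion structural.
  det-alternating-< : ∀ {n} m (M : Mat n) {i j} → toℕ j ≡ m → toℕ i < m →
    (∀ r → M r i ≈ M r j) → det M ≈ 0#
  det-alternating-< {suc n} (suc m) M {i} {suc j} j≡m i<m eq with i ≟ inject₁ j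
  ... | yes ≡.refl = det-adjacent M j eq
  ... | no i≢j = det-alternating-step M i≢j
    (λ { ≡.refl → ℕ.<-irrefl j≡m i<m })
    (λ e → ℕ.1+n≢n (≡.sym (≡.trans (≡.sym (toℕ-inject₁ j)) (≡.cong toℕ e))))
    (λ M′ → det-adjacent M′ j)
    (λ M′ → det-alternating-< m M′ j′≡m
      (ℕ.≤∧≢⇒< (ℕ.≤-pred i<m) λ i≡m → i≢j (toℕ-injective (≡.trans i≡m (≡.sym j′≡m)))))
    eq
    where
    j′≡m : toℕ (inject₁ j) ≡ m
    j′≡m = ≡.trans (toℕ-inject₁ j) (ℕ.suc-injective j≡m)

  det-alternating : ∀ {n} (M : Mat n) {i j} → i ≢ j → (∀ r → M r i ≈ M r j) → det M ≈ 0#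
  det-alternating M {i} {j} i≢j eq with ℕ.<-cmp (toℕ i) (toℕ j)
  ... | tri< i<j _ _ = det-alternating-< (toℕ j) M ≡.refl i<j eq
  ... | tri≈ _ i≡j _ = contradiction (toℕ-injective i≡j) i≢j
  ... | tri> _ _ j<i = det-alternating-< (toℕ i) M ≡.refl j<i (sym ∘ eq)

  -- Expanding column k by linearity leaves only the term i = k, because every other term has column
  -- i twice. The division-free form is the one that makes sense over dual numbers.
  cramer : ∀ {n} (M : Mat n) (y : Fin n → Carrier) k →
    det (replaceCol M k λ r → sum λ i → M r i * y i) ≈ y k * det M
  cramer M y k = begin
    det (replaceCol M k λ r → sum λ i → M r i * y i)
      ≈⟨ det-cong (replaceCol-cong k (λ _ _ → refl) λ r → sum-cong-≋ λ i → *-comm (M r i) (y i)) ⟩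
    det (replaceCol M k λ r → sum λ i → y i * M r i)
      ≈⟨ det-replaceCol-sum M k (λ i r → y i * M r i) ⟩
    sum (λ i → det (replaceCol M k λ r → y i * M r i))
      ≈⟨ sum-cong-≋ (λ i → det-replaceCol-* M k (y i) (λ r → M r i)) ⟩
    sum (λ i → y i * det (replaceCol M k λ r → M r i))
      ≈⟨ sum-single _ k (λ i i≢k → trans (*-congˡ (det-alternating (replaceCol M k λ r → M r i) {k} {i} (i≢k ∘ ≡.sym)
           λ r → trans (replaceCol-same M k (λ r → M r i) r) (sym (replaceCol-other M k (λ r → M r i) r i≢k)))) (zeroʳ _)) ⟩
    y k * det (replaceCol M k λ r → M r k)
      ≈⟨ *-congˡ (det-cong (replaceCol-unique {M′ = M} k (λ _ _ _ → refl) λ _ → refl)) ⟩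
    y k * det M ∎

-- Characteristic polynomials modulo x²

-- The source is a `RawRing`, so that determinants of matrices of coefficient lists can be
-- transported without ring laws for `Poly`.
record RingMap {a ℓ₁ c ℓ} (R : RawRing a ℓ₁) (S : CommutativeRing c ℓ) : Set (a ⊔ᴸ c ⊔ᴸ ℓ) where
  private module R = RawRing R
  open CommutativeRing S
  field
    f       : R.Carrier → Carrier
    +-homo  : ∀ x y → f (x R.+ y) ≈ f x + f y
    *-homo  : ∀ x y → f (x R.* y) ≈ f x * f y
    -‿homo  : ∀ x → f (R.- x) ≈ - f x
    0#-homo : f R.0# ≈ 0#
    1#-homo : f R.1# ≈ 1#

module DetHomomorphism {a ℓ₁ c ℓ} {R : RawRing a ℓ₁} {S : CommutativeRing c ℓ} (φ : RingMap R S) where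
  open CommutativeRing S hiding (zero)
  open RingMap φ
  open SumProperties semiring using (sum-cong-≋)
  private
    module R = RawRing R
    module RO = RawSemiringOps R.rawSemiring
    module SO = RawSemiringOps (RawRing.rawSemiring rawRing)
    module RD = Determinant R
    module SD = Determinant rawRing

  sum-homo : ∀ {n} (t : Fin n → R.Carrier) → f (RO.sum t) ≈ SO.sum (f ∘ t)
  sum-homo {zero} t = 0#-homo
  sum-homo {suc n} t = trans (+-homo _ _) (+-congˡ (sum-homo (t ∘ suc)))

  -1^-homo : ∀ k → f ((R.- R.1#) RO.^ k) ≈ (- 1#) SO.^ k
  -1^-homo zero = 1#-homo
  -1^-homo (suc k) =
    trans (*-homo _ _) (*-cong (trans (-‿homo _) (-‿cong 1#-homo)) (-1^-homo k))

  det-homo : ∀ {n} (M : Matrix R.Carrier n) → f (RD.det M) ≈ SD.det (λ i j → f (M i j))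
  det-homo {zero} M = 1#-homo
  det-homo {suc n} M = trans
    (sum-homo λ j → (R.- R.1#) RO.^ toℕ j R.* (M zero j R.* RD.det (minor j)))
    (sum-cong-≋ λ j → trans (*-homo ((R.- R.1#) RO.^ toℕ j) (M zero j R.* RD.det (minor j)))
      (*-cong (-1^-homo (toℕ j))
        (trans (*-homo (M zero j) (RD.det (minor j))) (*-congˡ (det-homo (minor j))))))
    where
    minor : Fin (suc n) → Matrix R.Carrier n
    minor j r s = M (suc r) (punchIn j s)

module PolynomialCoefficients {c ℓ} (R : CommutativeRing c ℓ) where
  open CommutativeRing R hiding (zero)
  open RingProperties ring using (-0#≈0#)
  open Polynomial rawRing

  coeff-+ : ∀ p q k → coeff (p +ₚ q) k ≈ coeff p k + coeff q k
  coeff-+ [] q k = sym (+-identityˡ _)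
  coeff-+ (a ∷ p) [] k = sym (+-identityʳ _)
  coeff-+ (a ∷ p) (b ∷ q) zero = refl
  coeff-+ (a ∷ p) (b ∷ q) (suc k) = coeff-+ p q k

  coeff-map-* : ∀ a p k → coeff (map (a *_) p) k ≈ a * coeff p k
  coeff-map-* a [] k = sym (zeroʳ a)
  coeff-map-* a (b ∷ p) zero = refl
  coeff-map-* a (b ∷ p) (suc k) = coeff-map-* a p k

  coeff-map-neg : ∀ p k → coeff (map -_ p) k ≈ - coeff p k
  coeff-map-neg [] k = sym -0#≈0#
  coeff-map-neg (b ∷ p) zero = refl
  coeff-map-neg (b ∷ p) (suc k) = coeff-map-neg p k

  coeff-∷-* : ∀ a p q k → coeff ((a ∷ p) *ₚ q) (suc k) ≈ a * coeff q (suc k) + coeff (p *ₚ q) k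
  coeff-∷-* a p q k = trans (coeff-+ (map (a *_) q) _ (suc k)) (+-congʳ (coeff-map-* a q (suc k)))

  coeff-*-0 : ∀ p q → coeff (p *ₚ q) 0 ≈ coeff p 0 * coeff q 0
  coeff-*-0 [] q = sym (zeroˡ _)
  coeff-*-0 (a ∷ p) q = trans (coeff-+ (map (a *_) q) _ 0)
    (trans (+-identityʳ _) (coeff-map-* a q 0))

  coeff-*-1 : ∀ p q → coeff (p *ₚ q) 1 ≈ coeff p 0 * coeff q 1 + coeff p 1 * coeff q 0
  coeff-*-1 [] q = sym (trans (+-cong (zeroˡ _) (zeroˡ _)) (+-identityˡ 0#))
  coeff-*-1 (a ∷ p) q = trans (coeff-∷-* a p q 0) (+-congˡ (coeff-*-0 p q))

  const-* : ∀ a p → const a *ₚ p ≈ₚ map (a *_) p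
  const-* a p zero = trans (coeff-+ (map (a *_) p) _ 0) (+-identityʳ _)
  const-* a p (suc k) = trans (coeff-+ (map (a *_) p) _ (suc k)) (+-identityʳ _)

  eval-0 : ∀ p → eval p 0# ≈ coeff p 0
  eval-0 [] = refl
  eval-0 (a ∷ p) = trans (+-congˡ (zeroˡ _)) (+-identityʳ a)

module DualNumbers {c ℓ} (R : CommutativeRing c ℓ) where
  open CommutativeRing R hiding (zero)
  open import Algebra.Solver.Ring.NaturalCoefficients.Default commutativeSemiring
    using (solve; _:=_; _:+_; _:*_)

  -- (a , b) stands for a + b ε, where ε² = 0.
  dual : CommutativeRing c ℓ
  dual = record
    { Carrier = Carrier × Carrier
    ; _≈_ = λ (a , b) (a′ , b′) → a ≈ a′ × b ≈ b′
    ; _+_ = λ (a , b) (a′ , b′) → a + a′ , b + b′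
    ; _*_ = λ (a , b) (a′ , b′) → a * a′ , a * b′ + b * a′
    ; -_ = λ (a , b) → - a , - b
    ; 0# = 0# , 0#
    ; 1# = 1# , 0#
    ; isCommutativeRing = record
      { isRing = record
        { +-isAbelianGroup = AbelianGroup.isAbelianGroup
            (DirectProduct.abelianGroup +-abelianGroup +-abelianGroup)
        ; *-cong = λ (p , q) (p′ , q′) → *-cong p p′ , +-cong (*-cong p q′) (*-cong q p′)
        ; *-assoc = λ (a , b) (a′ , b′) (a″ , b″) → *-assoc _ _ _ ,
            solve 6 (λ a b a′ b′ a″ b″ →
              a :* a′ :* b″ :+ (a :* b′ :+ b :* a′) :* a″ := a :* (a′ :* b″ :+ b′ :* a″) :+ b :* (a′ :* a″))
              refl a b a′ b′ a″ b″
        ; *-identity =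
            (λ _ → *-identityˡ _ , trans (+-cong (*-identityˡ _) (zeroˡ _)) (+-identityʳ _)) ,
            (λ _ → *-identityʳ _ , trans (+-cong (zeroʳ _) (*-identityʳ _)) (+-identityˡ _))
        ; distrib =
            (λ (a , b) (a′ , b′) (a″ , b″) → distribˡ _ _ _ ,
              solve 6 (λ a b a′ b′ a″ b″ →
                a :* (b′ :+ b″) :+ b :* (a′ :+ a″) := (a :* b′ :+ b :* a′) :+ (a :* b″ :+ b :* a″))
                refl a b a′ b′ a″ b″) ,
            (λ (a , b) (a′ , b′) (a″ , b″) → distribʳ _ _ _ ,
              solve 6 (λ a b a′ b′ a″ b″ →
                (a′ :+ a″) :* b :+ (b′ :+ b″) :* a := (a′ :* b :+ b′ :* a) :+ (a″ :* b :+ b″ :* a))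
                refl a b a′ b′ a″ b″)
        }
      ; *-comm = λ _ _ → *-comm _ _ , trans (+-comm _ _) (+-cong (*-comm _ _) (*-comm _ _))
      }
    }

module CharacteristicPolynomial {c ℓ} (R : CommutativeRing c ℓ) where
  open CommutativeRing R hiding (zero)
  open RingProperties ring using (-0#≈0#)
  open FiniteSums R
  open SumProperties semiring using (sum; sum-cong-≋)
  open Polynomial rawRing
  open PolynomialCoefficients R
  open DualNumbers R
  open Determinant rawRing using (det)
  open ColumnOperations R using (replaceCol; replaceCol-unique; det-cong; replaceCol-same; replaceCol-other)
  open Eigenvalue rawRing using () renaming (charPoly to χ)
  private
    module 𝔻 = CommutativeRing dual
    module 𝔻C = ColumnOperations dual
    module 𝔻Sum = SumProperties 𝔻.semiring
    module 𝔻Det = Determinant 𝔻.rawRing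
    module P = RawRing poly-rawRing

    -- Reduction modulo x², which retains just enough to tell multiplicity 0 from 1 and 1 from more.
    toDual : RingMap poly-rawRing dual
    toDual = record
      { f       = λ p → coeff p 0 , coeff p 1
      ; +-homo  = λ p q → coeff-+ p q 0 , coeff-+ p q 1
      ; *-homo  = λ p q → coeff-*-0 p q , coeff-*-1 p q
      ; -‿homo  = λ p → coeff-map-neg p 0 , coeff-map-neg p 1
      ; 0#-homo = refl , refl
      ; 1#-homo = refl , refl
      }

    realPart : RingMap 𝔻.rawRing R
    realPart = record
      { f       = proj₁
      ; +-homo  = λ _ _ → refl
      ; *-homo  = λ _ _ → refl
      ; -‿homo  = λ _ → refl
      ; 0#-homo = refl
      ; 1#-homo = refl
      }

    constantTerm : RingMap poly-rawRing R
    constantTerm = record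
      { f       = λ p → coeff p 0
      ; +-homo  = λ p q → coeff-+ p q 0
      ; *-homo  = coeff-*-0
      ; -‿homo  = λ p → coeff-map-neg p 0
      ; 0#-homo = refl
      ; 1#-homo = refl
      }

    module ToDual = DetHomomorphism toDual
    module RealPart = DetHomomorphism realPart
    module ConstantTerm = DetHomomorphism constantTerm

  -- The matrix inside `charPoly`, given a name such that `χ M` is its determinant by definition.
  charMatrix : ∀ {n} → Matrix Carrier n → Matrix Poly n
  charMatrix M i j = (if does (i ≟ j) then X else P.0#) +ₚ (P.- const (M i j))

  charMatrix-0 : ∀ {n} (M : Matrix Carrier n) i j → coeff (charMatrix M i j) 0 ≈ - M i j
  charMatrix-0 M i j with does (i ≟ j)
  ... | true = +-identityˡ _
  ... | false = refl

  charMatrix-1-diagonal : ∀ {n} (M : Matrix Carrier n) i → coeff (charMatrix M i i) 1 ≈ 1#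
  charMatrix-1-diagonal M i with i ≟ i
  ... | yes _ = refl
  ... | no i≢i = contradiction ≡.refl i≢i

  charMatrix-1-offDiagonal : ∀ {n} (M : Matrix Carrier n) {i j} → j ≢ i →
    coeff (charMatrix M i j) 1 ≈ 0#
  charMatrix-1-offDiagonal M {i} {j} j≢i with i ≟ j
  ... | yes i≡j = contradiction (≡.sym i≡j) j≢i
  ... | no _ = refl

  charPoly-0 : ∀ {n} (M : Matrix Carrier n) → coeff (χ M) 0 ≈ det (λ i j → - M i j)
  charPoly-0 M = trans (ConstantTerm.det-homo (charMatrix M)) (det-cong (charMatrix-0 M))

  module _ {n} (M : Matrix Carrier n) (z : Fin n → Carrier)
    (Mz≈0 : ∀ r → sum (λ j → M r j * z j) ≈ 0#) (k : Fin n) where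

    private
      E : Matrix 𝔻.Carrier n
      E i j = coeff (charMatrix M i j) 0 , coeff (charMatrix M i j) 1

      ẑ : Fin n → 𝔻.Carrier
      ẑ i = z i , 0#

      ε : 𝔻.Carrier
      ε = 0# , 1#

      proj₂-sum : ∀ {m} (t : Fin m → 𝔻.Carrier) → proj₂ (𝔻Sum.sum t) ≈ sum (proj₂ ∘ t)
      proj₂-sum {zero} t = refl
      proj₂-sum {suc m} t = +-congˡ (proj₂-sum (t ∘ suc))

      -- (ε I − M) z = ε z
      Eẑ : ∀ r → 𝔻Sum.sum (λ j → E r j 𝔻.* ẑ j) 𝔻.≈ ε 𝔻.* ẑ r
      Eẑ r = (begin
          proj₁ (𝔻Sum.sum λ j → E r j 𝔻.* ẑ j)
            ≈⟨ RealPart.sum-homo (λ j → E r j 𝔻.* ẑ j) ⟩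
          sum (λ j → coeff (charMatrix M r j) 0 * z j)
            ≈⟨ sum-cong-≋ (λ j → *-congʳ (charMatrix-0 M r j)) ⟩
          sum (λ j → - M r j * z j)
            ≈⟨ sum-neg-* (M r) z ⟩
          - sum (λ j → M r j * z j)
            ≈⟨ trans (-‿cong (Mz≈0 r)) -0#≈0# ⟩
          0#
            ≈⟨ zeroˡ (z r) ⟨
          0# * z r ∎) ,
        (begin
          proj₂ (𝔻Sum.sum λ j → E r j 𝔻.* ẑ j)
            ≈⟨ proj₂-sum (λ j → E r j 𝔻.* ẑ j) ⟩
          sum (λ j → coeff (charMatrix M r j) 0 * 0# + coeff (charMatrix M r j) 1 * z j)
            ≈⟨ sum-single _ r (λ j j≢r → trans (+-cong (zeroʳ _)
                 (*-≈0ˡ (z j) (charMatrix-1-offDiagonal M j≢r))) (+-identityˡ 0#)) ⟩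
          coeff (charMatrix M r r) 0 * 0# + coeff (charMatrix M r r) 1 * z r
            ≈⟨ +-cong (trans (zeroʳ _) (sym (zeroˡ _))) (*-congʳ (charMatrix-1-diagonal M r)) ⟩
          0# * 0# + 1# * z r ∎)
        where
        open SetoidReasoning setoid

      z*charPoly : ẑ k 𝔻.* (coeff (χ M) 0 , coeff (χ M) 1)
        𝔻.≈ ε 𝔻.* 𝔻Det.det (𝔻C.replaceCol E k ẑ)
      z*charPoly = begin
        ẑ k 𝔻.* (coeff (χ M) 0 , coeff (χ M) 1)
          ≈⟨ 𝔻.*-congˡ {ẑ k} (ToDual.det-homo (charMatrix M)) ⟩
        ẑ k 𝔻.* 𝔻Det.det E
          ≈⟨ 𝔻C.cramer E ẑ k ⟨
        𝔻Det.det (𝔻C.replaceCol E k λ r → 𝔻Sum.sum λ i → E r i 𝔻.* ẑ i)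
          ≈⟨ 𝔻C.det-cong (𝔻C.replaceCol-cong {M = E} {M′ = E} k (λ _ _ → 𝔻.refl) Eẑ) ⟩
        𝔻Det.det (𝔻C.replaceCol E k λ r → ε 𝔻.* ẑ r)
          ≈⟨ 𝔻C.det-replaceCol-* E k ε ẑ ⟩
        ε 𝔻.* 𝔻Det.det (𝔻C.replaceCol E k ẑ) ∎
        where open SetoidReasoning 𝔻.setoid

    charPoly-0-kernel : z k * coeff (χ M) 0 ≈ 0#
    charPoly-0-kernel = trans (proj₁ z*charPoly) (zeroˡ _)

    charPoly-1-kernel : z k * coeff (χ M) 1 ≈ det (replaceCol (λ i j → - M i j) k z)
    charPoly-1-kernel = begin
      z k * coeff (χ M) 1
        ≈⟨ trans (+-congˡ (zeroˡ _)) (+-identityʳ _) ⟨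
      z k * coeff (χ M) 1 + 0# * coeff (χ M) 0
        ≈⟨ proj₂ z*charPoly ⟩
      0# * proj₂ (𝔻Det.det (𝔻C.replaceCol E k ẑ)) + 1# * proj₁ (𝔻Det.det (𝔻C.replaceCol E k ẑ))
        ≈⟨ trans (+-cong (zeroˡ _) (*-identityˡ _)) (+-identityˡ _) ⟩
      proj₁ (𝔻Det.det (𝔻C.replaceCol E k ẑ))
        ≈⟨ RealPart.det-homo (𝔻C.replaceCol E k ẑ) ⟩
      det (λ i j → proj₁ (𝔻C.replaceCol E k ẑ i j))
        ≈⟨ det-cong (replaceCol-unique {M′ = λ i j → proj₁ (𝔻C.replaceCol E k ẑ i j)} k
             (λ i j j≢k → sym (trans (proj₁ (𝔻C.replaceCol-other E k ẑ i j≢k)) (charMatrix-0 M i j)))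
             (λ i → sym (proj₁ (𝔻C.replaceCol-same E k ẑ i)))) ⟨
      det (replaceCol (λ i j → - M i j) k z) ∎
      where open SetoidReasoning setoid

  multiplicity-0 : ∀ {n} (M : Matrix Carrier n) → ¬ (coeff (χ M) 0 ≈ 0#) →
    Eigenvalue.AlgebraicMultiplicity rawRing M 0# 0
  multiplicity-0 M ≉0 = χ M ,
    (λ k → sym (trans (const-* 1# (χ M) k) (trans (coeff-map-* 1# (χ M) k) (*-identityˡ _)))) ,
    λ ≈0 → ≉0 (trans (sym (eval-0 (χ M))) ≈0)

  multiplicity-1 : ∀ {n} (M : Matrix Carrier n) → coeff (χ M) 0 ≈ 0# → ¬ (coeff (χ M) 1 ≈ 0#) →
    Eigenvalue.AlgebraicMultiplicity rawRing M 0# 1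
  multiplicity-1 M p₀≈0 p₁≉0 = drop 1 (χ M) , factor ,
    λ ≈0 → p₁≉0 (trans (sym (coeff-drop (χ M) 0)) (trans (sym (eval-0 (drop 1 (χ M)))) ≈0))
    where
    open SetoidReasoning setoid

    coeff-drop : ∀ p k → coeff (drop 1 p) k ≈ coeff p (suc k)
    coeff-drop [] k = refl
    coeff-drop (a ∷ p) k = refl

    g : Poly
    g = drop 1 (χ M)

    -- The unsimplified coefficients to which the first power of x - 0 computes; this lets `factor`
    -- have exactly the type that `AlgebraicMultiplicity` asks for.
    x₀ x₁ : Carrier
    x₀ = (0# + - 0#) * 1# + 0#
    x₁ = 1# * 1# + 0#

    x₀≈0 : x₀ ≈ 0#
    x₀≈0 = trans (+-identityʳ _) (*-≈0ˡ 1# (-‿inverseʳ 0#))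

    factor : χ M ≈ₚ (x₀ ∷ x₁ ∷ []) *ₚ g
    factor zero = trans p₀≈0 (sym (trans (coeff-*-0 (x₀ ∷ x₁ ∷ []) g) (*-≈0ˡ _ x₀≈0)))
    factor (suc k) = begin
      coeff (χ M) (suc k)
        ≈⟨ coeff-drop (χ M) k ⟨
      coeff g k
        ≈⟨ trans (*-congʳ (trans (+-identityʳ _) (*-identityˡ 1#))) (*-identityˡ _) ⟨
      x₁ * coeff g k
        ≈⟨ trans (const-* x₁ g k) (coeff-map-* x₁ g k) ⟨
      coeff ((x₁ ∷ []) *ₚ g) k
        ≈⟨ trans (+-congʳ (*-≈0ˡ _ x₀≈0)) (+-identityˡ _) ⟨
      x₀ * coeff g (suc k) + coeff ((x₁ ∷ []) *ₚ g) k
        ≈⟨ coeff-∷-* x₀ (x₁ ∷ []) g k ⟨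
      coeff ((x₀ ∷ x₁ ∷ []) *ₚ g) (suc k) ∎

-- Linear systems over an integral domain with stable equality to 0

-- A substitute for a field with decidable equality: cancellation takes the place of division, and
-- stability permits x ≉ 0 to be assumed in a proof of x ≈ 0.
record IsStableDomain {c ℓ} (R : CommutativeRing c ℓ) : Set (c ⊔ᴸ ℓ) where
  open CommutativeRing R
  field
    stable   : ∀ {x} → ¬ ¬ (x ≈ 0#) → x ≈ 0#
    integral : ∀ {x y} → ¬ (x ≈ 0#) → x * y ≈ 0# → y ≈ 0#
    1≉0      : ¬ (1# ≈ 0#)

record PositiveCone {c ℓ} (R : CommutativeRing c ℓ) p : Set (c ⊔ᴸ ℓ ⊔ᴸ lsuc p) where
  open CommutativeRing R
  field
    Positive     : Carrier → Set p
    positive-+   : ∀ {x y} → Positive x → Positive y → Positive (x + y)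
    positive-*   : ∀ {x y} → Positive x → Positive y → Positive (x * y)
    positive⇒≉0 : ∀ {x} → Positive x → ¬ (x ≈ 0#)

module LinearSystems {c ℓ} (R : CommutativeRing c ℓ) (domain : IsStableDomain R) where
  open CommutativeRing R hiding (zero)
  open IsStableDomain domain
  open RingProperties ring using (-1*x≈-x; -‿involutive; -0#≈0#; -‿distribˡ-*)
  open SumProperties semiring
  open FiniteSums R
  open ColumnOperations R
  open Determinant rawRing using (det)
  open import Algebra.Definitions.RawSemiring (RawRing.rawSemiring rawRing) using (_^_)
  open import Algebra.Solver.Ring.NaturalCoefficients.Default commutativeSemiring
    using (solve; _:=_; _:+_; _:*_)
  open SetoidReasoning setoid

  Vect : ℕ → Set c
  Vect n = Fin n → Carrier

  infixr 7 _·_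
  _·_ : ∀ {m n} → (Fin m → Vect n) → Vect n → Vect m
  (A · z) r = sum λ j → A r j * z j

  Injective : ∀ {m n} → (Fin m → Vect n) → Set _
  Injective A = ∀ z → (∀ r → (A · z) r ≈ 0#) → ∀ j → z j ≈ 0#

  -- Failure of injectivity produces no actual vector. But if every kernel vector with a nonzero
  -- coordinate led to an absurdity, stability would make all coordinates vanish and A injective.
  noninjective-elim : ∀ {m n} (A : Fin m → Vect n) → ¬ Injective A →
    (∀ z → (∀ r → (A · z) r ≈ 0#) → ∀ k → ¬ (z k ≈ 0#) → ⊥) → ⊥
  noninjective-elim A ¬inj h = ¬inj λ z Az≈0 k → stable (h z Az≈0 k)

  ·-linear : ∀ {m n} (A : Fin m → Vect n) a z b y r →
    (A · λ j → a * z j + b * y j) r ≈ a * (A · z) r + b * (A · y) r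
  ·-linear A a z b y r = begin
    sum (λ j → A r j * (a * z j + b * y j))
      ≈⟨ sum-cong-≋ (λ j → solve 5 (λ m a z b y → m :* (a :* z :+ b :* y) := a :* (m :* z) :+ b :* (m :* y))
           refl (A r j) a (z j) b (y j)) ⟩
    sum (λ j → a * (A r j * z j) + b * (A r j * y j))
      ≈⟨ ∑-distrib-+ (λ j → a * (A r j * z j)) (λ j → b * (A r j * y j)) ⟩
    sum (λ j → a * (A r j * z j)) + sum (λ j → b * (A r j * y j))
      ≈⟨ +-cong (*-distribˡ-sum a (λ j → A r j * z j)) (*-distribˡ-sum b (λ j → A r j * y j)) ⟨
    a * (A · z) r + b * (A · y) r ∎

  ·-remove : ∀ {m n} (A : Fin m → Vect (suc n)) z k r → z k ≈ 0# →
    (A · z) r ≈ sum (λ j → A r (punchIn k j) * z (punchIn k j))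
  ·-remove A z k r zk≈0 = trans (sum-remove {i = k} (λ j → A r j * z j))
    (trans (+-congʳ (*-≈0ʳ (A r k) zk≈0)) (+-identityˡ _))

  insert0 : ∀ {n} → Fin (suc n) → Vect n → Vect (suc n)
  insert0 k z = insertAt z k 0#

  insert0-here : ∀ {n} k (z : Vect n) → insert0 k z k ≈ 0#
  insert0-here k z = reflexive (insertAt-lookup z k 0#)

  insert0-punchIn : ∀ {n} k (z : Vect n) j → insert0 k z (punchIn k j) ≈ z j
  insert0-punchIn k z j = reflexive (insertAt-punchIn z k 0# j)

  ·-insert0 : ∀ {m n} (A : Fin m → Vect (suc n)) k z r →
    (A · insert0 k z) r ≈ sum (λ j → A r (punchIn k j) * z j)
  ·-insert0 A k z r = trans (·-remove A (insert0 k z) k r (insert0-here k z))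
    (sum-cong-≋ λ j → *-congˡ (insert0-punchIn k z j))

  ·-symmetric : ∀ {n} (M : Fin n → Vect n) → (∀ i j → M i j ≈ M j i) → ∀ x y →
    sum (λ r → x r * (M · y) r) ≈ sum (λ s → y s * (M · x) s)
  ·-symmetric M M-sym x y = begin
    sum (λ r → x r * (M · y) r)
      ≈⟨ sum-cong-≋ (λ r → *-distribˡ-sum (x r) (λ s → M r s * y s)) ⟩
    sum (λ r → sum λ s → x r * (M r s * y s))
      ≈⟨ ∑-comm (λ r s → x r * (M r s * y s)) ⟩
    sum (λ s → sum λ r → x r * (M r s * y s))
      ≈⟨ sum-cong-≋ (λ s → sum-cong-≋ λ r → trans
           (solve 3 (λ x m y → x :* (m :* y) := y :* (m :* x)) refl (x r) (M r s) (y s))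
           (*-congˡ (*-congʳ (M-sym r s)))) ⟩
    sum (λ s → sum λ r → y s * (M s r * x r))
      ≈⟨ sum-cong-≋ (λ s → *-distribˡ-sum (y s) (λ r → M s r * x r)) ⟨
    sum (λ s → y s * (M · x) s) ∎

  -- A combination of z and y is killed by A, and y does not contribute to its
  -- coordinate k.
  solutions-proportional : ∀ {m n} (A : Fin (suc m) → Vect n) → Injective A → ∀ i z y →
    (∀ r → (A · z) (punchIn i r) ≈ 0#) → (∀ r → (A · y) (punchIn i r) ≈ 0#) →
    ∀ k → ¬ (z k ≈ 0#) → y k ≈ 0# → ∀ j → y j ≈ 0#
  solutions-proportional A inj i z y Az Ay k zk≉0 yk≈0 = inj y (everywhere y Ay f≈0)
    where
    everywhere : ∀ x → (∀ r → (A · x) (punchIn i r) ≈ 0#) → (A · x) i ≈ 0# → ∀ r → (A · x) r ≈ 0#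
    everywhere x Ax Axi r with i ≟ r
    ... | yes ≡.refl = Axi
    ... | no i≢r = ≡.subst (λ s → (A · x) s ≈ 0#) (punchIn-punchOut i≢r) (Ax (punchOut i≢r))
    f c′ : Carrier
    f = (A · y) i
    c′ = - (A · z) i
    t : Vect _
    t j = f * z j + c′ * y j
    cancel : f * (A · z) i + c′ * f ≈ 0#
    cancel = begin
      f * (A · z) i + - (A · z) i * f     ≈⟨ +-cong (*-comm _ _) (sym (-‿distribˡ-* _ _)) ⟩
      (A · z) i * f + - ((A · z) i * f)   ≈⟨ -‿inverseʳ _ ⟩
      0# ∎
    t≈0 : ∀ j → t j ≈ 0#
    t≈0 = inj t (everywhere t
      (λ r → trans (·-linear A f z c′ y (punchIn i r))
        (trans (+-cong (*-≈0ʳ f (Az r)) (*-≈0ʳ c′ (Ay r))) (+-identityˡ 0#)))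
      (trans (·-linear A f z c′ y i) cancel))
    f≈0 : f ≈ 0#
    f≈0 = integral zk≉0 (begin
      z k * f             ≈⟨ *-comm _ _ ⟩
      f * z k             ≈⟨ trans (+-congˡ (*-≈0ʳ c′ yk≈0)) (+-identityʳ _) ⟨
      f * z k + c′ * y k  ≈⟨ t≈0 k ⟩
      0# ∎)

  -- Induction without pivots. Once row 0 is dropped, the smaller case gives a solution z with a
  -- nonzero coordinate, and then a nonzero solution y that vanishes at that coordinate. For
  -- injective B this contradicts `solutions-proportional`.
  wide-noninjective : ∀ {n} (B : Fin n → Vect (suc n)) → ¬ Injective B
  wide-noninjective {zero} B inj = 1≉0 (inj (λ _ → 1#) (λ ()) zero)
  wide-noninjective {suc n} B inj =
    noninjective-elim B₁ (wide-noninjective B₁) λ z Bz k zk≉0 →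
    let B₂ = λ r j → B (suc r) (punchIn (suc k) j)
    in noninjective-elim B₂ (wide-noninjective B₂) λ y By k′ yk′≉0 →
    yk′≉0 (trans (sym (insert0-punchIn (suc k) y k′))
      (solutions-proportional B inj zero (insert0 zero z) (insert0 (suc k) y)
        (λ r → trans (·-insert0 B zero z (suc r)) (Bz r))
        (λ r → trans (·-insert0 B (suc k) y (suc r)) (By r))
        (suc k) zk≉0 (insert0-here (suc k) y) (punchIn (suc k) k′)))
    where
    B₁ : Fin n → Vect (suc n)
    B₁ r j = B (suc r) (suc j)

  wide-elim : ∀ {n} (B : Fin n → Vect (suc n)) →
    (∀ z → (∀ r → (B · z) r ≈ 0#) → ∀ k → ¬ (z k ≈ 0#) → ⊥) → ⊥
  wide-elim B = noninjective-elim B (wide-noninjective B)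

  -x≈0⇒x≈0 : ∀ {x} → - x ≈ 0# → x ≈ 0#
  -x≈0⇒x≈0 -x≈0 = trans (sym (-‿involutive _)) (trans (-‿cong -x≈0) -0#≈0#)

  -1^≉0 : ∀ k → ¬ ((- 1#) ^ k ≈ 0#)
  -1^≉0 zero = 1≉0
  -1^≉0 (suc k) h = -1^≉0 k (-x≈0⇒x≈0 (trans (sym (-1*x≈-x _)) h))

  det-zeroColumn : ∀ {n} (M : Mat n) k → (∀ r → M r k ≈ 0#) → det M ≈ 0#
  det-zeroColumn M k Mk≈0 = trans
    (det-linear {M = M} {M} {M} k 0# 0# (λ _ _ _ → refl) (λ _ _ _ → refl)
      λ r → trans (Mk≈0 r) (sym 0*x+0*y))
    0*x+0*y
    where
    0*x+0*y : ∀ {x y} → 0# * x + 0# * y ≈ 0#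
    0*x+0*y = trans (+-cong (zeroˡ _) (zeroˡ _)) (+-identityˡ 0#)

  det-replaceCol-0 : ∀ {n} (M : Mat (suc n)) k y → (∀ r → y (suc r) ≈ 0#) →
    det (replaceCol M k y) ≈ (- 1#) ^ toℕ k * (y zero * det (minor M k))
  det-replaceCol-0 M k y y≈0 = begin
    det M′
      ≈⟨ sum-single (laplaceTerm M′) k (λ j j≢k → *-≈0ʳ _ (*-≈0ʳ _
           (det-zeroColumn (minor M′ j) (punchOut j≢k) λ r →
             trans (reflexive (≡.cong (M′ (suc r)) (punchIn-punchOut j≢k)))
               (trans (replaceCol-same M k y (suc r)) (y≈0 r))))) ⟩
    (- 1#) ^ toℕ k * (M′ zero k * det (minor M′ k))
      ≈⟨ *-congˡ (*-cong (replaceCol-same M k y zero)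
           (det-cong λ r s → replaceCol-other M k y (suc r) (punchInᵢ≢i k s))) ⟩
    (- 1#) ^ toℕ k * (y zero * det (minor M k)) ∎
    where
    M′ : Mat _
    M′ = replaceCol M k y

  -- Let z solve all rows but the first, with z_k ≉ 0. Then T z has only its top entry nonzero, and
  -- Cramer's rule in column k equates that entry times the minor, up to sign, with z_k det T. So if
  -- det T vanished, the minor would too; by induction it would have a nonzero kernel vector, that
  -- is, a second solution, zero at k, against `solutions-proportional`.
  injective⇒det≉0 : ∀ {n} (T : Mat n) → Injective T → ¬ (det T ≈ 0#)
  injective⇒det≉0 {zero} T inj = 1≉0
  injective⇒det≉0 {suc n} T inj det≈0 =
    wide-elim (T ∘ suc) λ z Tz k zk≉0 →
    let [Tz]₀≉0 : ¬ ((T · z) zero ≈ 0#)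
        [Tz]₀≉0 e = zk≉0 (inj z (λ { zero → e ; (suc r) → Tz r }) k)
        minor≈0 : det (minor T k) ≈ 0#
        minor≈0 = integral [Tz]₀≉0 (integral (-1^≉0 (toℕ k))
          (trans (sym (det-replaceCol-0 T k (T · z) Tz)) (trans (cramer T z k) (*-≈0ʳ (z k) det≈0))))
    in noninjective-elim (minor T k) (λ inj′ → injective⇒det≉0 (minor T k) inj′ minor≈0) λ y Ty k′ yk′≉0 →
    yk′≉0 (trans (sym (insert0-punchIn k y k′))
      (solutions-proportional T inj zero z (insert0 k y) Tz
        (λ r → trans (·-insert0 T k y (suc r)) (Ty r))
        k zk≉0 (insert0-here k y) (punchIn k k′)))

  -- Deleting a vertex from a nonsingular symmetric bipartite matrix

  module VertexDeletion
    (definite : ∀ {n} (x : Vect n) → sum (λ i → x i * x i) ≈ 0# → ∀ i → x i ≈ 0#)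
    {n} (A : Fin (suc n) → Vect (suc n)) (A-sym : ∀ i j → A i j ≈ A j i) (A-inj : Injective A)
    (colour : Fin (suc n) → Bool) (bipartite : ∀ i j → colour i ≡ colour j → A i j ≈ 0#)
    (j : Fin (suc n)) where

    open Polynomial rawRing using (coeff)
    open Eigenvalue rawRing using () renaming (charPoly to χ)
    open CharacteristicPolynomial R

    M : Mat n
    M = deleteRowCol A j

    -- Otherwise the restriction of z to the colour class of j would be a
    -- nonzero vector in the kernel of A.
    solution-j : ∀ z → (∀ r → (A · z) (punchIn j r) ≈ 0#) → z j ≈ 0#
    solution-j z Az = trans (sym z°j) (A-inj z° Az° j)
      where
      z° : Vect (suc n)
      z° m = if does (colour m Bool.≟ colour j) then z m else 0#
      z°j : z° j ≈ z j
      z°j with colour j Bool.≟ colour j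
      ... | yes _ = refl
      ... | no q = contradiction ≡.refl q
      Az° : ∀ i → (A · z°) i ≈ 0#
      Az° i with colour i Bool.≟ colour j
      -- This case includes i = j, the one equation that z is not known to satisfy.
      ... | yes ci≡cj = sum-zero _ term
        where
        term : ∀ m → A i m * z° m ≈ 0#
        term m with colour m Bool.≟ colour j
        ... | yes cm≡cj = *-≈0ˡ (z m) (bipartite i m (≡.trans ci≡cj (≡.sym cm≡cj)))
        ... | no _ = zeroʳ (A i m)
      ... | no ci≢cj = trans (sum-cong-≋ term)
        (≡.subst (λ s → (A · z) s ≈ 0#) (punchIn-punchOut j≢i) (Az (punchOut j≢i)))
        where
        j≢i : j ≢ i
        j≢i e = ci≢cj (≡.cong colour (≡.sym e))
        term : ∀ m → A i m * z° m ≈ A i m * z m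
        term m with colour m Bool.≟ colour j
        ... | yes _ = refl
        ... | no cm≢cj = trans (zeroʳ (A i m)) (sym (*-≈0ˡ (z m)
          (bipartite i m (≡.trans (Bool.¬-not ci≢cj) (≡.sym (Bool.¬-not cm≢cj))))))

    -- A without row j has more columns than rows, hence a solution with a nonzero coordinate. As
    -- z_j vanishes, that coordinate survives the deletion. Both z and its restriction are passed
    -- on: z is compared with other solutions through A, while the restriction lies in the kernel of
    -- M.
    kernel-vector-elim : (∀ z → (∀ r → (A · z) (punchIn j r) ≈ 0#) →
      (∀ r → (M · (z ∘ punchIn j)) r ≈ 0#) → ∀ k → ¬ (z (punchIn j k) ≈ 0#) → ⊥) → ⊥
    kernel-vector-elim h = wide-elim (A ∘ punchIn j) λ z Az k zk≉0 →
      let zj≈0 = solution-j z Az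
          j≢k : j ≢ k
          j≢k = λ { ≡.refl → zk≉0 zj≈0 }
      in h z Az (λ r → trans (sym (·-remove A z j (punchIn j r) zj≈0)) (Az r))
        (punchOut j≢k) (≡.subst (λ s → ¬ (z s ≈ 0#)) (≡.sym (punchIn-punchOut j≢k)) zk≉0)

    charPoly-0≈0 : coeff (χ M) 0 ≈ 0#
    charPoly-0≈0 = stable λ ≉0 → kernel-vector-elim λ z Az Mz k zk≉0 →
      ≉0 (integral zk≉0 (charPoly-0-kernel M (z ∘ punchIn j) Mz k))

    module _ (z : Vect (suc n)) (Az : ∀ r → (A · z) (punchIn j r) ≈ 0#)
      (Mz : ∀ r → (M · (z ∘ punchIn j)) r ≈ 0#) (k : Fin n) (zk≉0 : ¬ (z (punchIn j k) ≈ 0#)) where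

      private
        z′ : Vect n
        z′ = z ∘ punchIn j

        T : Mat n
        T = replaceCol (λ r s → - M r s) k z′

        module _ (y : Vect n) (Ty : ∀ r → (T · y) r ≈ 0#) where

          y° : Vect n
          y° = updateAt y k λ _ → 0#

          y°-other : ∀ {s} → s ≢ k → y° s ≈ y s
          y°-other {s} s≢k = reflexive (updateAt-minimal s k y s≢k)

          -- Since y° drops the coordinate that multiplies the replaced column, T y is the
          -- difference of y_k z′ and M y°.
          My° : ∀ r → (M · y°) r ≈ z′ r * y k
          My° r = begin
            (M · y°) r
              ≈⟨ +-identityʳ _ ⟨
            (M · y°) r + 0#
              ≈⟨ +-congˡ (Ty r) ⟨
            (M · y°) r + (T · y) r
              ≈⟨ ∑-distrib-+ (λ s → M r s * y° s) (λ s → T r s * y s) ⟨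
            sum (λ s → M r s * y° s + T r s * y s)
              ≈⟨ sum-single _ k (λ s s≢k → begin
                   M r s * y° s + T r s * y s
                     ≈⟨ +-cong (*-congˡ (y°-other s≢k))
                               (*-congʳ (replaceCol-other (λ r s → - M r s) k z′ r s≢k)) ⟩
                   M r s * y s + - M r s * y s
                     ≈⟨ distribʳ (y s) (M r s) (- M r s) ⟨
                   (M r s + - M r s) * y s
                     ≈⟨ *-≈0ˡ (y s) (-‿inverseʳ _) ⟩
                   0# ∎) ⟩
            M r k * y° k + T r k * y k
              ≈⟨ +-cong (*-≈0ʳ (M r k) (reflexive (updateAt-updates k y)))
                        (*-congʳ (replaceCol-same (λ r s → - M r s) k z′ r)) ⟩
            0# + z′ r * y k
              ≈⟨ +-identityˡ _ ⟩
            z′ r * y k ∎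

          -- Pairing M y° = y_k z′ with z′ and moving the symmetric M over to z′, which it
          -- annihilates, gives y_k (z′ · z′) = 0. Definiteness excludes an isotropic z′, the case
          -- in which 0 would be a multiple root.
          yk≈0 : y k ≈ 0#
          yk≈0 = integral (λ z′z′≈0 → zk≉0 (definite z′ z′z′≈0 k)) (begin
            sum (λ r → z′ r * z′ r) * y k
              ≈⟨ *-distribʳ-sum (y k) (λ r → z′ r * z′ r) ⟩
            sum (λ r → z′ r * z′ r * y k)
              ≈⟨ sum-cong-≋ (λ r → trans (*-assoc _ _ _) (*-congˡ (sym (My° r)))) ⟩
            sum (λ r → z′ r * (M · y°) r)
              ≈⟨ ·-symmetric M (λ r s → A-sym (punchIn j r) (punchIn j s)) z′ y° ⟩
            sum (λ s → y° s * (M · z′) s)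
              ≈⟨ sum-zero _ (λ s → *-≈0ʳ (y° s) (Mz s)) ⟩
            0# ∎)

          -- With y_k zero, y° extended by 0 at j solves the same equations of A as z and vanishes
          -- at a coordinate where z does not.
          y°≈0 : ∀ s → y° s ≈ 0#
          y°≈0 s = trans (sym (insert0-punchIn j y° s))
            (solutions-proportional A A-inj j z (insert0 j y°) Az
              (λ r → trans (·-insert0 A j y° (punchIn j r)) (trans (My° r) (*-≈0ʳ (z′ r) yk≈0)))
              (punchIn j k) zk≉0
              (trans (insert0-punchIn j y° k) (reflexive (updateAt-updates k y)))
              (punchIn j s))

          y≈0 : ∀ s → y s ≈ 0#
          y≈0 s with s ≟ k
          ... | yes ≡.refl = yk≈0
          ... | no s≢k = trans (sym (y°-other s≢k)) (y°≈0 s)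

      bordered-det≉0 : ¬ (det T ≈ 0#)
      bordered-det≉0 = injective⇒det≉0 T y≈0

    charPoly-1≉0 : ¬ (coeff (χ M) 1 ≈ 0#)
    charPoly-1≉0 ≈0 = kernel-vector-elim λ z Az Mz k zk≉0 →
      bordered-det≉0 z Az Mz k zk≉0
        (trans (sym (charPoly-1-kernel M (z ∘ punchIn j) Mz k)) (*-≈0ʳ _ ≈0))

  charPoly-0≉0 : ∀ {n} (A : Mat n) → Injective A →
    ¬ (Polynomial.coeff rawRing (Eigenvalue.charPoly rawRing A) 0 ≈ 0#)
  charPoly-0≉0 A inj ≈0 = injective⇒det≉0 (λ i j → - A i j)
    (λ z Az → inj z λ r → -x≈0⇒x≈0 (begin
      - (A · z) r               ≈⟨ sum-neg-* (A r) z ⟨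
      sum (λ j → - A r j * z j) ≈⟨ Az r ⟩
      0# ∎))
    (trans (sym (CharacteristicPolynomial.charPoly-0 R A)) ≈0)

-- The ring of real numbers

private module ℚRing = RingProperties ℚ.+-*-ring

half : ∀ ε → 0ℚ ℚ.< ε → ∃[ δ ] 0ℚ ℚ.< δ × δ ℚ.+ δ ≡ ε
half ε 0<ε = ½ ℚ.* ε ,
  ≡.subst (ℚ._< ½ ℚ.* ε) (ℚ.*-zeroʳ ½) (ℚ.*-monoʳ-<-pos ½ 0<ε) ,
  ≡.trans (≡.sym (ℚ.*-distribʳ-+ ε ½ ½)) (ℚ.*-identityˡ ε)

Null : (ℕ → ℚ) → Set
Null s = ∀ ε → 0ℚ ℚ.< ε → ∃[ N ] ∀ n → N ℕ.≤ n → ∣ s n ∣ ℚ.< ε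

Bounded : (ℕ → ℚ) → Set
Bounded s = ∃[ K ] ℚ.Positive K × (∃[ N ] ∀ n → N ℕ.≤ n → ∣ s n ∣ ℚ.≤ K)

-- The positive counterpart of being nonzero. For Cauchy sequences `Null` is equivalent to
-- `¬ Apart`; being a negation, it is stable.
Apart : (ℕ → ℚ) → Set
Apart s = ∃[ δ ] 0ℚ ℚ.< δ × (∃[ N ] ∀ n → N ℕ.≤ n → δ ℚ.< ∣ s n ∣)

module _ where
  open ℚ.≤-Reasoning

  Null-cong : ∀ {s t} → (∀ n → s n ≡ t n) → Null s → Null t
  Null-cong s≡t hs ε 0<ε with hs ε 0<ε
  ... | N , h = N , λ n N≤n → ≡.subst (λ q → ∣ q ∣ ℚ.< ε) (s≡t n) (h n N≤n)

  Null-≤ : ∀ {s t} → (∀ n → ∣ t n ∣ ℚ.≤ ∣ s n ∣) → Null s → Null t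
  Null-≤ t≤s hs ε 0<ε with hs ε 0<ε
  ... | N , h = N , λ n N≤n → ℚ.≤-<-trans (t≤s n) (h n N≤n)

  Null-0 : ∀ {s} → (∀ n → s n ≡ 0ℚ) → Null s
  Null-0 s≡0 ε 0<ε = 0 , λ n _ → ≡.subst (λ q → ∣ q ∣ ℚ.< ε) (≡.sym (s≡0 n)) 0<ε

  Null-neg : ∀ {s} → Null s → Null (λ n → ℚ.- s n)
  Null-neg {s} = Null-≤ λ n → ℚ.≤-reflexive (ℚ.∣-p∣≡∣p∣ (s n))

  Null-+ : ∀ {s t} → Null s → Null t → Null (λ n → s n ℚ.+ t n)
  Null-+ {s} {t} hs ht ε 0<ε with half ε 0<ε
  ... | δ , 0<δ , ≡.refl with hs δ 0<δ | ht δ 0<δ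
  ... | N , h | M , k = N ⊔ M , λ n l → begin-strict
    ∣ s n ℚ.+ t n ∣      ≤⟨ ℚ.∣p+q∣≤∣p∣+∣q∣ (s n) (t n) ⟩
    ∣ s n ∣ ℚ.+ ∣ t n ∣  <⟨ ℚ.+-mono-< (h n (ℕ.m⊔n≤o⇒m≤o N M l)) (k n (ℕ.m⊔n≤o⇒n≤o N M l)) ⟩
    δ ℚ.+ δ              ∎

  Null-* : ∀ {s t} → Bounded s → Null t → Null (λ n → s n ℚ.* t n)
  Null-* {s} {t} (K , K>0 , N , h) ht ε 0<ε = N ⊔ proj₁ (ht δ 0<δ) , λ n l → begin-strict
    ∣ s n ℚ.* t n ∣
      ≡⟨ ℚ.∣p*q∣≡∣p∣*∣q∣ (s n) (t n) ⟩
    ∣ s n ∣ ℚ.* ∣ t n ∣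
      ≤⟨ ℚ.*-monoʳ-≤-nonNeg ∣ t n ∣ {{ℚ.∣-∣-nonNeg (t n)}} (h n (ℕ.m⊔n≤o⇒m≤o N _ l)) ⟩
    K ℚ.* ∣ t n ∣
      <⟨ ℚ.*-monoʳ-<-pos K (proj₂ (ht δ 0<δ) n (ℕ.m⊔n≤o⇒n≤o N _ l)) ⟩
    K ℚ.* (ℚ.1/ K ℚ.* ε)
      ≡⟨ ℚ.*-assoc K (ℚ.1/ K) ε ⟨
    (K ℚ.* ℚ.1/ K) ℚ.* ε
      ≡⟨ ≡.cong (ℚ._* ε) (ℚ.*-inverseʳ K) ⟩
    1ℚ ℚ.* ε
      ≡⟨ ℚ.*-identityˡ ε ⟩
    ε ∎
    where
    instance
      _ : ℚ.Positive K
      _ = K>0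
      _ : ℚ.NonZero K
      _ = ℚ.pos⇒nonZero K
      _ : ℚ.Positive (ℚ.1/ K)
      _ = ℚ.1/pos⇒pos K
    δ : ℚ
    δ = ℚ.1/ K ℚ.* ε
    0<δ : 0ℚ ℚ.< δ
    0<δ = ≡.subst (ℚ._< δ) (ℚ.*-zeroʳ (ℚ.1/ K)) (ℚ.*-monoʳ-<-pos (ℚ.1/ K) 0<ε)

  Apart⇒¬Null : ∀ {s} → Apart s → ¬ Null s
  Apart⇒¬Null (δ , 0<δ , N , h) hs with hs δ 0<δ
  ... | M , k = ℚ.<-asym (h (N ⊔ M) (ℕ.m≤m⊔n N M)) (k (N ⊔ M) (ℕ.m≤n⊔m N M))

  Apart-* : ∀ {s t} → Apart s → Apart t → Apart (λ n → s n ℚ.* t n)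
  Apart-* {s} {t} (δ , 0<δ , N , h) (γ , 0<γ , M , k) = δ ℚ.* γ , 0<δγ , N ⊔ M , λ n l →
    begin-strict
    δ ℚ.* γ
      <⟨ ℚ.*-monoʳ-<-pos δ {{ℚ.positive 0<δ}} (k n (ℕ.m⊔n≤o⇒n≤o N M l)) ⟩
    δ ℚ.* ∣ t n ∣
      ≤⟨ ℚ.*-monoʳ-≤-nonNeg ∣ t n ∣ {{ℚ.∣-∣-nonNeg (t n)}} (ℚ.<⇒≤ (h n (ℕ.m⊔n≤o⇒m≤o N M l))) ⟩
    ∣ s n ∣ ℚ.* ∣ t n ∣
      ≡⟨ ℚ.∣p*q∣≡∣p∣*∣q∣ (s n) (t n) ⟨
    ∣ s n ℚ.* t n ∣ ∎
    where
    0<δγ : 0ℚ ℚ.< δ ℚ.* γ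
    0<δγ = ℚ.positive⁻¹ _ {{ℚ.pos*pos⇒pos δ {{ℚ.positive 0<δ}} γ {{ℚ.positive 0<γ}}}}

  -- With ε = 4δ, a single rational comparison decides: let the terms from N on differ by less than
  -- δ. If the term at N is below 2δ in absolute value, all later ones are below 3δ; otherwise all
  -- later ones exceed δ, and the sequence would be apart from 0.
  ¬Apart⇒Null : ∀ {s} → Cauchy s → ¬ Apart s → Null s
  ¬Apart⇒Null {s} cs ¬apart ε 0<ε with half ε 0<ε
  ... | η , 0<η , ≡.refl with half η 0<η
  ... | δ , 0<δ , ≡.refl with cs δ 0<δ
  ... | N , h with ∣ s N ∣ ℚ.<? δ ℚ.+ δ
  ... | yes sN<2δ = N , λ n N≤n → begin-strict
    ∣ s n ∣                       ≡⟨ ≡.cong ∣_∣ (subtract-add (s n) (s N)) ⟨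
    ∣ (s n ℚ.- s N) ℚ.+ s N ∣     ≤⟨ ℚ.∣p+q∣≤∣p∣+∣q∣ (s n ℚ.- s N) (s N) ⟩
    ∣ s n ℚ.- s N ∣ ℚ.+ ∣ s N ∣   <⟨ ℚ.+-mono-< (h n N N≤n ℕ.≤-refl) sN<2δ ⟩
    δ ℚ.+ (δ ℚ.+ δ)               ≤⟨ ℚ.+-monoˡ-≤ (δ ℚ.+ δ) δ≤2δ ⟩
    (δ ℚ.+ δ) ℚ.+ (δ ℚ.+ δ)       ∎
    where
    δ≤2δ : δ ℚ.≤ δ ℚ.+ δ
    δ≤2δ = ≡.subst (ℚ._≤ δ ℚ.+ δ) (ℚ.+-identityʳ δ) (ℚ.+-monoʳ-≤ δ (ℚ.<⇒≤ 0<δ))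
  ... | no sN≮2δ = contradiction (δ , 0<δ , N , λ n N≤n → ℚ.≰⇒> λ sn≤δ → sN≮2δ (begin-strict
    ∣ s N ∣                       ≡⟨ ≡.cong ∣_∣ (subtract-add (s N) (s n)) ⟨
    ∣ (s N ℚ.- s n) ℚ.+ s n ∣     ≤⟨ ℚ.∣p+q∣≤∣p∣+∣q∣ (s N ℚ.- s n) (s n) ⟩
    ∣ s N ℚ.- s n ∣ ℚ.+ ∣ s n ∣   <⟨ ℚ.+-mono-<-≤ (h N n ℕ.≤-refl N≤n) sn≤δ ⟩
    δ ℚ.+ δ                       ∎)) ¬apart

≈0⇒Null : ∀ {x} → x ≈ℝ 0ℝ → Null (seq x)
≈0⇒Null {x} = Null-cong λ n → ℚ.+-identityʳ (seq x n)

Null⇒≈0 : ∀ {x} → Null (seq x) → x ≈ℝ 0ℝ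
Null⇒≈0 {x} = Null-cong λ n → ≡.sym (ℚ.+-identityʳ (seq x n))

≗⇒≈ℝ : ∀ {x y} → (∀ n → seq x n ≡ seq y n) → x ≈ℝ y
≗⇒≈ℝ {x} {y} x≡y = Null-0 λ n →
  ≡.trans (≡.cong (ℚ._- seq y n) (x≡y n)) (ℚ.+-inverseʳ (seq y n))

-- The placeholders are solved by the type of `isCommutativeRing`. The raw ring of this bundle is
-- thus `ℝ-rawRing` by definition, and the general results speak of the given characteristic
-- polynomial.
ℝ-commutativeRing : CommutativeRing 0ℓ 0ℓ
ℝ-commutativeRing = record
  { Carrier = ℝ
  ; _≈_ = _≈ℝ_
  ; _+_ = _
  ; _*_ = _
  ; -_ = _
  ; 0# = _
  ; 1# = _
  ; isCommutativeRing = isCommutativeRing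
  }
  where
  open import Algebra.Structures _≈ℝ_ using (IsCommutativeRing)
  open RawRing ℝ-rawRing using (_+_; _*_; -_; 0#; 1#)

  symℝ : ∀ {x y} → x ≈ℝ y → y ≈ℝ x
  symℝ {x} {y} = Null-cong (λ n → -[p-q]≡q-p (seq x n) (seq y n)) ∘ Null-neg
    where
    -[p-q]≡q-p : ∀ p q → ℚ.- (p ℚ.- q) ≡ q ℚ.- p
    -[p-q]≡q-p p q = ≡.trans (ℚ.neg-distrib-+ p (ℚ.- q))
      (≡.trans (≡.cong (ℚ.- p ℚ.+_) (ℚRing.-‿involutive q)) (ℚ.+-comm (ℚ.- p) q))

  isCommutativeRing : IsCommutativeRing _+_ _*_ -_ 0# 1#
  isCommutativeRing = record
    { isRing = record
      { +-isAbelianGroup = record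
        { isGroup = record
          { isMonoid = record
            { isSemigroup = record
              { isMagma = record
                { isEquivalence = record
                  { refl = λ {x} → ≗⇒≈ℝ {x} {x} λ _ → ≡.refl
                  ; sym = λ {x} {y} → symℝ {x} {y}
                  ; trans = λ {x} {y} {z} x≈y y≈z → Null-cong
                      (λ n → telescope (seq x n) (seq y n) (seq z n)) (Null-+ x≈y y≈z)
                  }
                ; ∙-cong = λ {x} {x′} {y} {y′} x≈ y≈ → Null-cong
                    (λ n → ≡.sym (sum-difference (seq x n) (seq y n) (seq x′ n) (seq y′ n)))
                    (Null-+ x≈ y≈)
                }
              ; assoc = λ x y z → ≗⇒≈ℝ {(x + y) + z} {x + (y + z)} λ n → ℚ.+-assoc (seq x n) (seq y n) (seq z n)
              }
            ; identity = (λ x → ≗⇒≈ℝ {0# + x} {x} λ n → ℚ.+-identityˡ (seq x n)) ,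
                         (λ x → ≗⇒≈ℝ {x + 0#} {x} λ n → ℚ.+-identityʳ (seq x n))
            }
          ; inverse = (λ x → ≗⇒≈ℝ { - x + x} {0#} λ n → ℚ.+-inverseˡ (seq x n)) ,
                      (λ x → ≗⇒≈ℝ {x + - x} {0#} λ n → ℚ.+-inverseʳ (seq x n))
          ; ⁻¹-cong = λ {x} {y} x≈y → Null-cong
              (λ n → ℚ.neg-distrib-+ (seq x n) (ℚ.- seq y n)) (Null-neg x≈y)
          }
        ; comm = λ x y → ≗⇒≈ℝ {x + y} {y + x} λ n → ℚ.+-comm (seq x n) (seq y n)
        }
      ; *-cong = λ {x} {x′} {y} {y′} x≈ y≈ → Null-cong
          (λ n → ≡.sym (product-difference (seq x n) (seq y n) (seq x′ n) (seq y′ n)))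
          (Null-+ (Null-* (bounded (seq x) (cauchy x)) y≈) (Null-* (bounded (seq y′) (cauchy y′)) x≈))
      ; *-assoc = λ x y z → ≗⇒≈ℝ {(x * y) * z} {x * (y * z)} λ n → ℚ.*-assoc (seq x n) (seq y n) (seq z n)
      ; *-identity = (λ x → ≗⇒≈ℝ {1# * x} {x} λ n → ℚ.*-identityˡ (seq x n)) ,
                     (λ x → ≗⇒≈ℝ {x * 1#} {x} λ n → ℚ.*-identityʳ (seq x n))
      ; distrib = (λ x y z → ≗⇒≈ℝ {x * (y + z)} {x * y + x * z} λ n → ℚ.*-distribˡ-+ (seq x n) (seq y n) (seq z n)) ,
                  (λ x y z → ≗⇒≈ℝ {(y + z) * x} {y * x + z * x} λ n → ℚ.*-distribʳ-+ (seq x n) (seq y n) (seq z n))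
      }
    ; *-comm = λ x y → ≗⇒≈ℝ {x * y} {y * x} λ n → ℚ.*-comm (seq x n) (seq y n)
    }

-- Stability, definiteness and positivity of real numbers

module _ where
  open CommutativeRing ℝ-commutativeRing using (_+_; _*_)
  open SumProperties (CommutativeRing.semiring ℝ-commutativeRing) using (sum)

  Annihilates : ∀ {N} → Matrix ℝ N → (Fin N → ℝ) → Set
  Annihilates A x = ∀ i → sum (λ j → A i j * x j) ≈ℝ 0ℝ

  ≈0-stable : ∀ {x} → ¬ ¬ (x ≈ℝ 0ℝ) → x ≈ℝ 0ℝ
  ≈0-stable {x} ¬¬x≈0 = Null⇒≈0 {x} (¬Apart⇒Null (cauchy x) λ apart →
    ¬¬x≈0 (Apart⇒¬Null apart ∘ ≈0⇒Null {x}))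

  -- Under the negations both x and y may be taken apart from 0, and then so is their product.
  ℝ-integral : ∀ {x y} → ¬ (x ≈ℝ 0ℝ) → x * y ≈ℝ 0ℝ → y ≈ℝ 0ℝ
  ℝ-integral {x} {y} x≉0 xy≈0 = Null⇒≈0 {y} (¬Apart⇒Null (cauchy y) λ y# →
    x≉0 (Null⇒≈0 {x} (¬Apart⇒Null (cauchy x) λ x# →
      Apart⇒¬Null (Apart-* x# y#) (≈0⇒Null {x * y} xy≈0))))

  square-nonNegative : ∀ p → 0ℚ ℚ.≤ p ℚ.* p
  square-nonNegative p = ≡.subst (0ℚ ℚ.≤_) (∣p∣*∣p∣≡p*p (ℚ.∣p∣≡p∨∣p∣≡-p p))
    (ℚ.nonNegative⁻¹ _ {{ℚ.nonNeg*nonNeg⇒nonNeg (∣ p ∣) {{ℚ.∣-∣-nonNeg p}} (∣ p ∣) {{ℚ.∣-∣-nonNeg p}}}})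
    where
    ∣p∣*∣p∣≡p*p : ∣ p ∣ ≡ p ⊎ ∣ p ∣ ≡ ℚ.- p → ∣ p ∣ ℚ.* ∣ p ∣ ≡ p ℚ.* p
    ∣p∣*∣p∣≡p*p (inj₁ e) = ≡.cong₂ ℚ._*_ e e
    ∣p∣*∣p∣≡p*p (inj₂ e) = ≡.trans (≡.cong₂ ℚ._*_ e e) (≡.trans (≡.sym (ℚ.neg-distribˡ-* p (ℚ.- p)))
      (≡.trans (≡.cong ℚ.-_ (≡.sym (ℚ.neg-distribʳ-* p p))) (ℚRing.-‿involutive (p ℚ.* p))))

  sum-squares-nonNegative : ∀ {m} (x : Fin m → ℝ) n → 0ℚ ℚ.≤ seq (sum λ i → x i * x i) n
  sum-squares-nonNegative {zero} x n = ℚ.≤-refl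
  sum-squares-nonNegative {suc m} x n =
    ℚ.+-mono-≤ (square-nonNegative (seq (x zero) n)) (sum-squares-nonNegative (x ∘ suc) n)

  ∣p∣≤∣p+q∣ : ∀ {p q} → 0ℚ ℚ.≤ p → 0ℚ ℚ.≤ q → ∣ p ∣ ℚ.≤ ∣ p ℚ.+ q ∣
  ∣p∣≤∣p+q∣ {p} {q} 0≤p 0≤q = ≡.subst₂ ℚ._≤_
    (≡.trans (ℚ.+-identityʳ p) (≡.sym (ℚ.0≤p⇒∣p∣≡p 0≤p)))
    (≡.sym (ℚ.0≤p⇒∣p∣≡p (ℚ.+-mono-≤ 0≤p 0≤q)))
    (ℚ.+-monoʳ-≤ p 0≤q)

  ∣q∣≤∣p+q∣ : ∀ {p q} → 0ℚ ℚ.≤ p → 0ℚ ℚ.≤ q → ∣ q ∣ ℚ.≤ ∣ p ℚ.+ q ∣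
  ∣q∣≤∣p+q∣ {p} {q} 0≤p 0≤q =
    ≡.subst (λ r → ∣ q ∣ ℚ.≤ ∣ r ∣) (ℚ.+-comm q p) (∣p∣≤∣p+q∣ 0≤q 0≤p)

  -- Squares are nonnegative term by term in the representing sequences, so the head and the tail of
  -- the sum are each dominated by the whole and are null with it.
  ℝ-definite : ∀ {m} (x : Fin m → ℝ) → sum (λ i → x i * x i) ≈ℝ 0ℝ → ∀ i → x i ≈ℝ 0ℝ
  ℝ-definite {suc m} x h = λ where
      zero → ≈0-stable {x zero} λ x≉0 → x≉0 (ℝ-integral {x zero} {x zero} x≉0
        (Null⇒≈0 {x zero * x zero} (Null-≤ (λ n → ∣p∣≤∣p+q∣ (head≥0 n) (tail≥0 n)) null)))
      (suc i) → ℝ-definite (x ∘ suc)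
        (Null⇒≈0 {tail} (Null-≤ (λ n → ∣q∣≤∣p+q∣ (head≥0 n) (tail≥0 n)) null)) i
    where
    tail : ℝ
    tail = sum λ i → x (suc i) * x (suc i)
    null : Null (seq (sum λ i → x i * x i))
    null = ≈0⇒Null {sum λ i → x i * x i} h
    head≥0 : ∀ n → 0ℚ ℚ.≤ seq (x zero * x zero) n
    head≥0 n = square-nonNegative (seq (x zero) n)
    tail≥0 : ∀ n → 0ℚ ℚ.≤ seq tail n
    tail≥0 = sum-squares-nonNegative (x ∘ suc)

  0<⇒Apart : ∀ {x} → 0ℝ <ℝ x → Apart (seq x)
  0<⇒Apart {x} (ε , 0<ε , N , h) = ε , 0<ε , N , λ n N≤n →
    let ε<x : ε ℚ.< seq x n
        ε<x = ≡.subst (ℚ._< seq x n) (ℚ.+-identityˡ ε) (h n N≤n)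
    in ≡.subst (ε ℚ.<_) (≡.sym (ℚ.0≤p⇒∣p∣≡p (ℚ.<⇒≤ (ℚ.<-trans 0<ε ε<x)))) ε<x

  0<⇒≉0 : ∀ {x} → 0ℝ <ℝ x → ¬ (x ≈ℝ 0ℝ)
  0<⇒≉0 {x} 0<x = Apart⇒¬Null (0<⇒Apart {x} 0<x) ∘ ≈0⇒Null {x}

  0<1ℝ : 0ℝ <ℝ 1ℝ
  0<1ℝ = ½ , ℚ.positive⁻¹ ½ , 0 , λ _ _ → ≡.subst (ℚ._< 1ℚ) (≡.sym (ℚ.+-identityˡ ½)) (ℚ.+-monoˡ-< ½ (ℚ.positive⁻¹ ½))

  0<-+ : ∀ {x y} → 0ℝ <ℝ x → 0ℝ <ℝ y → 0ℝ <ℝ x + y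
  0<-+ {x} {y} (ε , 0<ε , N , h) (δ , 0<δ , M , k) = ε ℚ.+ δ , ℚ.+-mono-< 0<ε 0<δ , N ⊔ M ,
    λ n l → ≡.subst (ℚ._< seq x n ℚ.+ seq y n) (sum-0 ε δ)
      (ℚ.+-mono-< (h n (ℕ.m⊔n≤o⇒m≤o N M l)) (k n (ℕ.m⊔n≤o⇒n≤o N M l)))
    where
    sum-0 : ∀ p q → (0ℚ ℚ.+ p) ℚ.+ (0ℚ ℚ.+ q) ≡ 0ℚ ℚ.+ (p ℚ.+ q)
    sum-0 p q = ≡.trans (≡.cong₂ ℚ._+_ (ℚ.+-identityˡ p) (ℚ.+-identityˡ q)) (≡.sym (ℚ.+-identityˡ _))

  0<-* : ∀ {x y} → 0ℝ <ℝ x → 0ℝ <ℝ y → 0ℝ <ℝ x * y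
  0<-* {x} {y} (ε , 0<ε , N , h) (δ , 0<δ , M , k) = ε ℚ.* δ ,
    ℚ.positive⁻¹ _ {{ℚ.pos*pos⇒pos ε {{ℚ.positive 0<ε}} δ {{ℚ.positive 0<δ}}}} , N ⊔ M , λ n l →
    let ε<x : ε ℚ.< seq x n
        ε<x = ≡.subst (ℚ._< seq x n) (ℚ.+-identityˡ ε) (h n (ℕ.m⊔n≤o⇒m≤o N M l))
        δ<y : δ ℚ.< seq y n
        δ<y = ≡.subst (ℚ._< seq y n) (ℚ.+-identityˡ δ) (k n (ℕ.m⊔n≤o⇒n≤o N M l))
    in begin-strict
      0ℚ ℚ.+ ε ℚ.* δ         ≡⟨ ℚ.+-identityˡ _ ⟩
      ε ℚ.* δ                <⟨ ℚ.*-monoʳ-<-pos ε {{ℚ.positive 0<ε}} δ<y ⟩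
      ε ℚ.* seq y n          <⟨ ℚ.*-monoˡ-<-pos (seq y n) {{ℚ.positive (ℚ.<-trans 0<δ δ<y)}} ε<x ⟩
      seq x n ℚ.* seq y n    ∎
    where open ℚ.≤-Reasoning

ℝ-isStableDomain : IsStableDomain ℝ-commutativeRing
ℝ-isStableDomain = record
  { stable   = λ {x} → ≈0-stable {x}
  ; integral = λ {x} {y} → ℝ-integral {x} {y}
  ; 1≉0      = 0<⇒≉0 {1ℝ} 0<1ℝ
  }

ℝ-positiveCone : PositiveCone ℝ-commutativeRing 0ℓ
ℝ-positiveCone = record
  { Positive     = 0ℝ <ℝ_
  ; positive-+   = λ {x} {y} → 0<-+ {x} {y}
  ; positive-*   = λ {x} {y} → 0<-* {x} {y}
  ; positive⇒≉0 = λ {x} → 0<⇒≉0 {x}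
  }

-- Kernels of weighted graphs

parity : ℕ → Bool
parity zero = false
parity (suc n) = not (parity n)

parity-double : ∀ k → parity (k ℕ.* 2) ≡ false
parity-double zero = ≡.refl
parity-double (suc k) = ≡.trans (Bool.not-involutive _) (parity-double k)

halve : ∀ k → ∃[ j ] (k ≡ j ℕ.* 2 ⊎ k ≡ suc (j ℕ.* 2))
halve zero = 0 , inj₁ ≡.refl
halve (suc k) with halve k
... | j , inj₁ e = j , inj₂ (≡.cong suc e)
... | j , inj₂ e = suc j , inj₁ (≡.cong suc e)

-- Walks around a cycle, indexed by ℕ modulo its length

module CyclicOrder {n : ℕ} where

  private
    a : ℕ
    a = suc n

    toℕ-mod : ∀ k → toℕ (k mod a) ≡ k % a
    toℕ-mod k = toℕ-fromℕ< (m%n<n k a)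

    suc-% : ∀ k → suc k % a ≡ suc (k % a) % a
    suc-% k = ≡.trans (≡.cong (λ t → suc t % a) (m≡m%n+[m/n]*n k a))
      ([m+kn]%n≡m%n (suc (k % a)) (k / a) a)

  cyclicSuc-mod : ∀ k → CyclicSuc (k mod a) (suc k mod a)
  cyclicSuc-mod k with suc (k % a) ℕ.<? a
  ... | yes k+1<a = inj₁ (≡.trans (toℕ-mod (suc k))
    (≡.trans (suc-% k) (≡.trans (m<n⇒m%n≡m k+1<a) (≡.cong suc (≡.sym (toℕ-mod k))))))
  ... | no k+1≮a = inj₂ (≡.trans (≡.cong suc (toℕ-mod k)) k+1≡a ,
    ≡.trans (toℕ-mod (suc k)) (≡.trans (suc-% k) (≡.trans (≡.cong (_% a) k+1≡a) (n%n≡0 a))))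
    where
    k+1≡a : suc (k % a) ≡ a
    k+1≡a = ℕ.≤-antisym (m%n<n k a) (ℕ.≮⇒≥ k+1≮a)

  toℕ-mod-inverse : ∀ (i : Fin a) → toℕ i mod a ≡ i
  toℕ-mod-inverse i = toℕ-injective (≡.trans (toℕ-mod (toℕ i)) (m<n⇒m%n≡m (toℕ<n i)))

  mod-period : ∀ k → (k ℕ.+ a) mod a ≡ k mod a
  mod-period k = toℕ-injective
    (≡.trans (toℕ-mod (k ℕ.+ a)) (≡.trans ([m+n]%n≡m%n k a) (≡.sym (toℕ-mod k))))

  cyclicSuc-functional : ∀ {i j j′ : Fin a} → CyclicSuc i j → CyclicSuc i j′ → j ≡ j′
  cyclicSuc-functional (inj₁ p) (inj₁ q) = toℕ-injective (≡.trans p (≡.sym q))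
  cyclicSuc-functional {j = j} (inj₁ p) (inj₂ (q , _)) = contradiction (≡.trans p q) (ℕ.<⇒≢ (toℕ<n j))
  cyclicSuc-functional {j′ = j′} (inj₂ (q , _)) (inj₁ p) = contradiction (≡.trans p q) (ℕ.<⇒≢ (toℕ<n j′))
  cyclicSuc-functional (inj₂ (_ , p)) (inj₂ (_ , q)) = toℕ-injective (≡.trans p (≡.sym q))

  cyclicSuc-injective : ∀ {i i′ j : Fin a} → CyclicSuc i j → CyclicSuc i′ j → i ≡ i′
  cyclicSuc-injective (inj₁ p) (inj₁ q) = toℕ-injective (ℕ.suc-injective (≡.trans (≡.sym p) q))
  cyclicSuc-injective (inj₁ p) (inj₂ (_ , q)) = contradiction (≡.trans (≡.sym p) q) ℕ.1+n≢0
  cyclicSuc-injective (inj₂ (_ , q)) (inj₁ p) = contradiction (≡.trans (≡.sym p) q) ℕ.1+n≢0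
  cyclicSuc-injective (inj₂ (p , _)) (inj₂ (q , _)) = toℕ-injective (ℕ.suc-injective (≡.trans p (≡.sym q)))

  -- On a cycle of length at least 3 the two neighbours of a vertex are distinct, as
  -- `two-neighbours` demands.
  cyclicSuc²-irreflexive : 2 ℕ.< a → ∀ {i j : Fin a} → CyclicSuc i j → ¬ CyclicSuc j i
  cyclicSuc²-irreflexive 2<a {i} (inj₁ p) (inj₁ q) =
    ℕ.m≢1+n+m (toℕ i) {1} (≡.trans q (≡.cong suc p))
  cyclicSuc²-irreflexive 2<a (inj₁ p) (inj₂ (q , r)) =
    ℕ.<⇒≢ 2<a (≡.trans (≡.cong suc (≡.sym (≡.trans p (≡.cong suc r)))) q)
  cyclicSuc²-irreflexive 2<a (inj₂ (q , r)) (inj₁ p) =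
    ℕ.<⇒≢ 2<a (≡.trans (≡.cong suc (≡.sym (≡.trans p (≡.cong suc r)))) q)
  cyclicSuc²-irreflexive 2<a (inj₂ (_ , r)) (inj₂ (q , _)) =
    ℕ.<⇒≢ (ℕ.<-trans (ℕ.n<1+n 1) 2<a) (≡.trans (≡.cong suc (≡.sym r)) q)

  cyclicSuc-parity : parity a ≡ false → ∀ {i j : Fin a} → CyclicSuc i j →
    parity (toℕ j) ≡ not (parity (toℕ i))
  cyclicSuc-parity _ (inj₁ p) = ≡.cong parity p
  cyclicSuc-parity a-even (inj₂ (p , q)) =
    ≡.trans (≡.cong parity q) (≡.sym (≡.trans (≡.cong parity p) a-even))

  parity-mod : parity a ≡ false → ∀ k → parity (toℕ (k mod a)) ≡ parity k
  parity-mod a-even zero = ≡.refl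
  parity-mod a-even (suc k) = ≡.trans (cyclicSuc-parity a-even (cyclicSuc-mod k))
    (≡.cong not (parity-mod a-even k))

open CyclicOrder

module OppositeSigns {c ℓ p} (R : CommutativeRing c ℓ) (domain : IsStableDomain R)
  (cone : PositiveCone R p) where
  open CommutativeRing R hiding (zero)
  open IsStableDomain domain using (integral)
  open PositiveCone cone
  open FiniteSums R using (*-≈0ʳ)
  open import Algebra.Solver.Ring.NaturalCoefficients.Default commutativeSemiring
    using (solve; _:=_; _:+_; _:*_)
  open SetoidReasoning setoid

  -- Opposite signs or both zero, said without a case distinction on the sign of a real.
  Opposite : Carrier → Carrier → Set _
  Opposite x y = ∃[ α ] ∃[ β ] Positive α × Positive β × α * x + β * y ≈ 0#

  -- An alternating combination of the three equations eliminates y and z. The middle one is added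
  -- on the other side instead of subtracted, because the solver works in semirings.
  opposite³ : ∀ {x y z t} → Opposite x y → Opposite y z → Opposite z t → Opposite x t
  opposite³ {x} {y} {z} {t} (α , β , 0<α , 0<β , p) (γ , δ , 0<γ , 0<δ , q) (ε , ζ , 0<ε , 0<ζ , r) =
    α * (γ * ε) , β * (δ * ζ) ,
    positive-* 0<α (positive-* 0<γ 0<ε) , positive-* 0<β (positive-* 0<δ 0<ζ) , (begin
      α * (γ * ε) * x + β * (δ * ζ) * t
        ≈⟨ trans (+-congˡ (*-≈0ʳ (β * ε) q)) (+-identityʳ _) ⟨
      (α * (γ * ε) * x + β * (δ * ζ) * t) + β * ε * (γ * y + δ * z)
        ≈⟨ solve 10 (λ α β γ δ ε ζ x y z t →
             (α :* (γ :* ε) :* x :+ β :* (δ :* ζ) :* t) :+ β :* ε :* (γ :* y :+ δ :* z)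
             := γ :* ε :* (α :* x :+ β :* y) :+ β :* δ :* (ε :* z :+ ζ :* t))
             refl α β γ δ ε ζ x y z t ⟩
      γ * ε * (α * x + β * y) + β * δ * (ε * z + ζ * t)
        ≈⟨ trans (+-cong (*-≈0ʳ (γ * ε) p) (*-≈0ʳ (β * δ) r)) (+-identityˡ 0#) ⟩
      0# ∎)

  opposite-self : ∀ {x} → Opposite x x → x ≈ 0#
  opposite-self {x} (α , β , 0<α , 0<β , p) =
    integral (positive⇒≉0 (positive-+ 0<α 0<β)) (trans (distribʳ x α β) p)

  opposite-0 : ∀ {x y} → Opposite x y → x ≈ 0# → y ≈ 0#
  opposite-0 {x} {y} (α , β , 0<α , 0<β , p) x≈0 = integral (positive⇒≉0 0<β) (begin
    β * y          ≈⟨ trans (+-congʳ (*-≈0ʳ α x≈0)) (+-identityˡ _) ⟨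
    α * x + β * y  ≈⟨ p ⟩
    0#             ∎)

  odd-cycle : ∀ (e : ℕ → Carrier) → (∀ k → Opposite (e k) (e (suc k))) →
    ∀ m → e (suc (m ℕ.+ m)) ≡ e 0 → ∀ k → e k ≈ 0#
  odd-cycle e opp m periodic zero =
    opposite-self (≡.subst (Opposite (e 0)) periodic (odd-opposite m))
    where
    odd-opposite : ∀ m → Opposite (e 0) (e (suc (m ℕ.+ m)))
    odd-opposite zero = opp 0
    odd-opposite (suc m) = ≡.subst (λ k → Opposite (e 0) (e (suc (suc k)))) (≡.sym (ℕ.+-suc m m))
      (opposite³ (odd-opposite m) (opp (suc (m ℕ.+ m))) (opp (suc (suc (m ℕ.+ m)))))
  odd-cycle e opp m periodic (suc k) = opposite-0 (opp k) (odd-cycle e opp m periodic k)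

open OppositeSigns ℝ-commutativeRing ℝ-isStableDomain ℝ-positiveCone

-- Equations of a kernel vector at single vertices

module KernelOnGraph {N} (P : SignPattern N) (P-sym : SymmetricPattern P)
  (nonnegative : NonnegativePattern P) (H : Graph) (iso : underlyingGraph P P-sym ≅ H)
  (A : Matrix ℝ N) (A∈Q : Q-SYM P A)
  (x : Fin N → ℝ) (Ax≈0 : Annihilates A x) where

  open Graph H
  open Inverse (_≅_.vertices iso) using (to; from; strictlyInverseˡ; strictlyInverseʳ)
  open CommutativeRing ℝ-commutativeRing using (_*_)
  open FiniteSums ℝ-commutativeRing using (*-≈0ʳ; *-≈0ˡ; sum≈0⇒single≈0; sum≈0⇒pair≈0)

  X : Vertex → ℝ
  X c = x (from c)

  private
    weight-positive : ∀ {c d} → c ~ d → 0ℝ <ℝ A (from c) (from d)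
    weight-positive {c} {d} c~d with nonnegative (from c) (from d) | proj₂ A∈Q (from c) (from d)
    ... | inj₁ P≡pos | s rewrite P≡pos = s
    ... | inj₂ P≡zer | _ = contradiction P≡zer
      (Equivalence.from (_≅_.adjacency iso (from c) (from d))
        (≡.subst₂ _~_ (≡.sym (strictlyInverseˡ c)) (≡.sym (strictlyInverseˡ d)) c~d))

    term≈0 : ∀ c j → (c ~ to j → X (to j) ≈ℝ 0ℝ) → A (from c) j * x j ≈ℝ 0ℝ
    term≈0 c j h with nonnegative (from c) j | proj₂ A∈Q (from c) j
    ... | inj₂ P≡zer | s rewrite P≡zer = *-≈0ˡ {A (from c) j} (x j) s
    ... | inj₁ P≡pos | _ = *-≈0ʳ (A (from c) j) {x j} (≡.subst (λ k → x k ≈ℝ 0ℝ) (strictlyInverseʳ j)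
      (h (≡.subst (_~ to j) (strictlyInverseˡ c) (Equivalence.to (_≅_.adjacency iso (from c) j)
        (≡.subst (_≢ zer) (≡.sym P≡pos) λ ())))))

    to≡⇒ : ∀ {j d} → to j ≡ d → j ≡ from d
    to≡⇒ {j} e = ≡.trans (≡.sym (strictlyInverseʳ j)) (≡.cong from e)

  one-neighbour : ∀ {c d} → c ~ d → (∀ {e} → c ~ e → e ≡ d ⊎ X e ≈ℝ 0ℝ) → X d ≈ℝ 0ℝ
  one-neighbour {c} {d} c~d others =
    ℝ-integral {A (from c) (from d)} {X d} (0<⇒≉0 {A (from c) (from d)} (weight-positive c~d))
      (sum≈0⇒single≈0 (λ j → A (from c) j * x j) (from d) vanish (Ax≈0 (from c)))
    where
    vanish : ∀ j → j ≢ from d → A (from c) j * x j ≈ℝ 0ℝ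
    vanish j j≢d = term≈0 c j λ c~j → case (others c~j)
      where
      case : to j ≡ d ⊎ X (to j) ≈ℝ 0ℝ → X (to j) ≈ℝ 0ℝ
      case (inj₁ e) = contradiction (to≡⇒ e) j≢d
      case (inj₂ h) = h

  -- Row c of `Annihilates` is itself the required relation, with two positive weights as its
  -- coefficients.
  two-neighbours : ∀ {c b d} → b ≢ d → c ~ b → c ~ d →
    (∀ {e} → c ~ e → e ≡ b ⊎ e ≡ d ⊎ X e ≈ℝ 0ℝ) → Opposite (X b) (X d)
  two-neighbours {c} {b} {d} b≢d c~b c~d others =
    A (from c) (from b) , A (from c) (from d) , weight-positive c~b , weight-positive c~d ,
    sum≈0⇒pair≈0 (λ j → A (from c) j * x j) from-b≢from-d vanish (Ax≈0 (from c))
    where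
    from-b≢from-d : from b ≢ from d
    from-b≢from-d e = b≢d (≡.trans (≡.sym (strictlyInverseˡ b)) (≡.trans (≡.cong to e) (strictlyInverseˡ d)))
    vanish : ∀ j → j ≢ from b → j ≢ from d → A (from c) j * x j ≈ℝ 0ℝ
    vanish j j≢b j≢d = term≈0 c j λ c~j → case (others c~j)
      where
      case : to j ≡ b ⊎ to j ≡ d ⊎ X (to j) ≈ℝ 0ℝ → X (to j) ≈ℝ 0ℝ
      case (inj₁ e) = contradiction (to≡⇒ e) j≢b
      case (inj₂ (inj₁ e)) = contradiction (to≡⇒ e) j≢d
      case (inj₂ (inj₂ h)) = h

  -- A cycle of length 4m + 2 that is attached to the rest of the graph only at
  -- its vertex 0.
  module PendantCycle (m : ℕ) (0<m : 0 ℕ.< m) (ι : Fin (suc (m ℕ.+ m) ℕ.* 2) → Vertex)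
    (ι-injective : ∀ {i j} → ι i ≡ ι j → i ≡ j)
    (ι-edge : ∀ {i j} → CyclicSuc i j → ι i ~ ι j)
    (Outer : Vertex → Set)
    (ι-neighbour : ∀ i {e} → ι i ~ e →
      (∃[ j ] e ≡ ι j × (CyclicSuc i j ⊎ CyclicSuc j i)) ⊎ (toℕ i ≡ 0 × Outer e)) where

    private
      a : ℕ
      a = suc (m ℕ.+ m) ℕ.* 2

      2<a : 2 ℕ.< a
      2<a = ℕ.*-monoˡ-< 2 {1} {suc (m ℕ.+ m)} (s<s (ℕ.≤-trans 0<m (ℕ.m≤m+n m m)))

      a-even : parity a ≡ false
      a-even = parity-double (suc (m ℕ.+ m))

      U : ℕ → Vertex
      U k = ι (k mod a)

      U-neighbour : ∀ k → (∀ {e} → toℕ (suc k mod a) ≡ 0 → Outer e → X e ≈ℝ 0ℝ) →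
        ∀ {e} → U (suc k) ~ e → e ≡ U k ⊎ e ≡ U (suc (suc k)) ⊎ X e ≈ℝ 0ℝ
      U-neighbour k outer c~e with ι-neighbour (suc k mod a) c~e
      ... | inj₁ (j , e≡ , inj₁ s) = inj₂ (inj₁ (≡.trans e≡
        (≡.cong ι (cyclicSuc-functional s (cyclicSuc-mod (suc k))))))
      ... | inj₁ (j , e≡ , inj₂ s) = inj₁ (≡.trans e≡
        (≡.cong ι (cyclicSuc-injective s (cyclicSuc-mod k))))
      ... | inj₂ (i≡0 , o) = inj₂ (inj₂ (outer i≡0 o))

      -- The walk starts at vertex i and advances by 2, across vertices whose equations make their
      -- two neighbours opposite; 2m + 1 such steps go round the cycle once. `outer` concerns the
      -- crossed vertices only. For i = 0 these are odd and miss the attachment vertex 0; for i = 1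
      -- vertex 0 is crossed, so its outer neighbours must already be known to vanish.
      alternate-zero : ∀ i →
        (∀ k {e} → toℕ (suc (k ℕ.* 2 ℕ.+ i) mod a) ≡ 0 → Outer e → X e ≈ℝ 0ℝ) →
        ∀ k → X (U (k ℕ.* 2 ℕ.+ i)) ≈ℝ 0ℝ
      alternate-zero i outer = odd-cycle (λ k → X (U (k ℕ.* 2 ℕ.+ i)))
        (λ k → two-neighbours {U (suc (k ℕ.* 2 ℕ.+ i))}
          (λ e → cyclicSuc²-irreflexive 2<a (cyclicSuc-mod (k ℕ.* 2 ℕ.+ i))
            (≡.subst (CyclicSuc (suc (k ℕ.* 2 ℕ.+ i) mod a)) (≡.sym (ι-injective e))
              (cyclicSuc-mod (suc (k ℕ.* 2 ℕ.+ i)))))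
          (~-sym (ι-edge (cyclicSuc-mod (k ℕ.* 2 ℕ.+ i))))
          (ι-edge (cyclicSuc-mod (suc (k ℕ.* 2 ℕ.+ i))))
          (U-neighbour (k ℕ.* 2 ℕ.+ i) (outer k)))
        m (≡.cong (X ∘ ι) (≡.trans (≡.cong (_mod a) (ℕ.+-comm a i)) (mod-period i)))

    even-zero : ∀ k → X (ι (k ℕ.* 2 mod a)) ≈ℝ 0ℝ
    even-zero k = ≡.subst (λ t → X (U t) ≈ℝ 0ℝ) (ℕ.+-identityʳ (k ℕ.* 2)) (alternate-zero 0 centre≢0 k)
      where
      centre≢0 : ∀ k {e} → toℕ (suc (k ℕ.* 2 ℕ.+ 0) mod a) ≡ 0 → Outer e → X e ≈ℝ 0ℝ
      centre≢0 k eq _ = contradiction (begin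
        true                                       ≡⟨ ≡.cong not (parity-double k) ⟨
        parity (suc (k ℕ.* 2))                     ≡⟨ ≡.cong (parity ∘ suc) (ℕ.+-identityʳ (k ℕ.* 2)) ⟨
        parity (suc (k ℕ.* 2 ℕ.+ 0))               ≡⟨ parity-mod a-even (suc (k ℕ.* 2 ℕ.+ 0)) ⟨
        parity (toℕ (suc (k ℕ.* 2 ℕ.+ 0) mod a))   ≡⟨ ≡.cong parity eq ⟩
        false                                      ∎) λ ()
        where open ≡.≡-Reasoning

    cycle-zero : (∀ {e} → Outer e → X e ≈ℝ 0ℝ) → ∀ i → X (ι i) ≈ℝ 0ℝ
    cycle-zero outer i with halve (toℕ i)
    ... | k , inj₁ e = ≡.subst (λ j → X (ι j) ≈ℝ 0ℝ)
      (≡.trans (≡.cong (_mod a) (≡.sym e)) (toℕ-mod-inverse i)) (even-zero k)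
    ... | k , inj₂ e = ≡.subst (λ j → X (ι j) ≈ℝ 0ℝ)
      (≡.trans (≡.cong (_mod a) (≡.trans (ℕ.+-comm _ 1) (≡.sym e))) (toℕ-mod-inverse i))
      (alternate-zero 1 (λ _ _ → outer) k)

-- The dumbbell graph

open import Data.Nat.Base using (_+_; _*_)

module Dumbbell (m n l : ℕ) where

  -- The lengths 4m + 2 and 4n + 2 are written as doubled odd numbers: the odd factor is the number
  -- of vertices at even distance, and `parity-double` applies directly.
  a b s : ℕ
  a = suc (m + m) * 2
  b = suc (n + n) * 2
  s = l * 2

  V : Set
  V = DumbbellVertex a b s

  open Graph (dumbbell a b s) using (_~_)

  -- Inverts `PathAt` on the path; the remaining cycle vertices merely share the value of their
  -- attachment vertex.
  position : V → ℕ
  position (u _) = 0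
  position (v i) = suc (toℕ i)
  position (w _) = suc s

  position≤ : ∀ x → position x ≤ suc s
  position≤ (u _) = z≤n
  position≤ (v i) = s≤s (ℕ.<⇒≤ (toℕ<n i))
  position≤ (w _) = ℕ.≤-refl

  pathAt-position : ∀ {k} {x : V} → PathAt k x → position x ≡ k
  pathAt-position (start _) = ≡.refl
  pathAt-position internal = ≡.refl
  pathAt-position (end _) = ≡.refl

  pathAt-≤ : ∀ {k} {x : V} → PathAt k x → k ≤ suc s
  pathAt-≤ {x = x} at = ≡.subst (_≤ suc s) (pathAt-position at) (position≤ x)

  pathAt-unique : ∀ {k k′} {x y : V} → PathAt k x → PathAt k′ y → k ≡ k′ → x ≡ y
  pathAt-unique (start p) (start q) _ = ≡.cong u (toℕ-injective (≡.trans p (≡.sym q)))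
  pathAt-unique internal internal e = ≡.cong v (toℕ-injective (ℕ.suc-injective e))
  pathAt-unique (end p) (end q) _ = ≡.cong w (toℕ-injective (≡.trans p (≡.sym q)))
  pathAt-unique (start _) internal ()
  pathAt-unique (start _) (end _) ()
  pathAt-unique internal (start _) ()
  pathAt-unique internal (end _) e = contradiction (ℕ.suc-injective e) (ℕ.<⇒≢ (toℕ<n _))
  pathAt-unique (end _) (start _) ()
  pathAt-unique (end _) internal e = contradiction (ℕ.suc-injective (≡.sym e)) (ℕ.<⇒≢ (toℕ<n _))

  -- The second cycle has its colours exchanged because its attachment vertex lies at the odd
  -- distance s + 1 from that of the first.
  colour : V → Bool
  colour (u i) = parity (toℕ i)
  colour (v i) = parity (suc (toℕ i))
  colour (w i) = not (parity (toℕ i))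

  pathAt-colour : ∀ {k} {x : V} → PathAt k x → colour x ≡ parity k
  pathAt-colour (start p) = ≡.cong parity p
  pathAt-colour internal = ≡.refl
  pathAt-colour (end p) = ≡.cong not (≡.trans (≡.cong parity p) (≡.sym (parity-double l)))

  edge-colour : ∀ {x y : V} → DumbbellEdge x y → colour y ≡ not (colour x)
  edge-colour (cycleᵤ c) = CyclicOrder.cyclicSuc-parity (parity-double (suc (m + m))) c
  edge-colour (cycle𝓌 c) = ≡.cong not (CyclicOrder.cyclicSuc-parity (parity-double (suc (n + n))) c)
  edge-colour (path p q) = ≡.trans (pathAt-colour q) (≡.cong not (≡.sym (pathAt-colour p)))

  ~-colour : ∀ {x y} → x ~ y → colour x ≢ colour y
  ~-colour (fwd e) eq = Bool.not-¬ (≡.sym eq) (edge-colour e)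
  ~-colour (bwd e) eq = Bool.not-¬ eq (edge-colour e)

  u-neighbour : ∀ i {e} → u i ~ e →
    (∃[ j ] e ≡ u j × (CyclicSuc i j ⊎ CyclicSuc j i)) ⊎ (toℕ i ≡ 0 × PathAt 1 e)
  u-neighbour i (fwd (cycleᵤ c)) = inj₁ (_ , ≡.refl , inj₁ c)
  u-neighbour i (bwd (cycleᵤ c)) = inj₁ (_ , ≡.refl , inj₂ c)
  u-neighbour i (fwd (path (start p) q)) = inj₂ (p , q)
  u-neighbour i (bwd (path p ()))

  w-neighbour : ∀ i {e} → w i ~ e →
    (∃[ j ] e ≡ w j × (CyclicSuc i j ⊎ CyclicSuc j i)) ⊎ (toℕ i ≡ 0 × PathAt s e)
  w-neighbour i (fwd (cycle𝓌 c)) = inj₁ (_ , ≡.refl , inj₁ c)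
  w-neighbour i (bwd (cycle𝓌 c)) = inj₁ (_ , ≡.refl , inj₂ c)
  w-neighbour i (fwd (path (end _) q)) = contradiction (pathAt-≤ q) ℕ.1+n≰n
  w-neighbour i (bwd (path p (end q))) = inj₂ (q , p)

  v-neighbour : ∀ i {e} → v i ~ e → PathAt (toℕ i) e ⊎ PathAt (suc (suc (toℕ i))) e
  v-neighbour i (fwd (path internal q)) = inj₂ q
  v-neighbour i (bwd (path p internal)) = inj₁ p

  u-injective : ∀ {i j} → _≡_ {A = V} (u i) (u j) → i ≡ j
  u-injective ≡.refl = ≡.refl

  w-injective : ∀ {i j} → _≡_ {A = V} (w i) (w j) → i ≡ j
  w-injective ≡.refl = ≡.refl

  module Kernel (0<m : 0 < m) (0<n : 0 < n)
    {N} (P : SignPattern N) (P-sym : SymmetricPattern P)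
    (nonnegative : NonnegativePattern P) (iso : underlyingGraph P P-sym ≅ dumbbell a b s)
    (A : Matrix ℝ N) (A∈Q : Q-SYM P A) (x : Fin N → ℝ)
    (Ax≈0 : Annihilates A x) where

    open Inverse (_≅_.vertices iso) using (to; strictlyInverseʳ)
    open KernelOnGraph P P-sym nonnegative (dumbbell a b s) iso A A∈Q x Ax≈0

    private
      module U = PendantCycle m 0<m u u-injective (fwd ∘ cycleᵤ) (PathAt 1) u-neighbour
      module W = PendantCycle n 0<n w w-injective (fwd ∘ cycle𝓌) (PathAt s) w-neighbour

      -- Beyond the end of the path the claim is vacuous, so `zeroAt-even` can run over all k.
      ZeroAt : ℕ → Set
      ZeroAt k = ∀ {e} → PathAt k e → X e ≈ℝ 0ℝ

      internalVertex : ∀ {k} → k < s → ∃[ i ] toℕ i ≡ k × PathAt {a} {b} {s} (suc k) (v i)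
      internalVertex k<s = fromℕ< k<s , toℕ-fromℕ< k<s ,
        ≡.subst (λ t → PathAt {a} {b} {s} (suc t) (v (fromℕ< k<s))) (toℕ-fromℕ< k<s) internal

      zeroAt-start : ZeroAt 0
      zeroAt-start (start p) = ≡.subst (λ i → X (u i) ≈ℝ 0ℝ) (toℕ-injective (≡.sym p)) (U.even-zero 0)

      zeroAt-end : ∀ {k} → k ≡ suc s → ZeroAt k
      zeroAt-end e (end p) = ≡.subst (λ i → X (w i) ≈ℝ 0ℝ) (toℕ-injective (≡.sym p)) (W.even-zero 0)
      zeroAt-end () (start _)
      zeroAt-end e internal = contradiction (ℕ.suc-injective e) (ℕ.<⇒≢ (toℕ<n _))

      zeroAt-step : ∀ k → ZeroAt k → ZeroAt (suc (suc k))
      zeroAt-step k zero-k {e} at with internalVertex (ℕ.≤-pred (pathAt-≤ at))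
      ... | i , ≡.refl , at′ = one-neighbour {v i} (fwd (path at′ at)) λ c~e′ → case (v-neighbour i c~e′)
        where
        case : ∀ {e′} → PathAt (toℕ i) e′ ⊎ PathAt (suc (suc (toℕ i))) e′ → e′ ≡ e ⊎ X e′ ≈ℝ 0ℝ
        case (inj₁ q) = inj₂ (zero-k q)
        case (inj₂ q) = inj₁ (pathAt-unique q at ≡.refl)

      zeroAt-step⁻¹ : ∀ k → k < s → ZeroAt (suc (suc k)) → ZeroAt k
      zeroAt-step⁻¹ k k<s zero-k+2 {e} at with internalVertex k<s
      ... | i , ≡.refl , at′ = one-neighbour {v i} (bwd (path at at′)) λ c~e′ → case (v-neighbour i c~e′)
        where
        case : ∀ {e′} → PathAt (toℕ i) e′ ⊎ PathAt (suc (suc (toℕ i))) e′ → e′ ≡ e ⊎ X e′ ≈ℝ 0ℝ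
        case (inj₁ q) = inj₁ (pathAt-unique q at ≡.refl)
        case (inj₂ q) = inj₂ (zero-k+2 q)

      zeroAt-even : ∀ k → ZeroAt (k * 2)
      zeroAt-even zero = zeroAt-start
      zeroAt-even (suc k) = zeroAt-step (k * 2) (zeroAt-even k)

      -- Here t counts steps of 2 back from the second attachment vertex. Its place s + 1 is odd, so
      -- these zeros fill the odd places while `zeroAt-even` fills the even ones; for odd s both
      -- ends would reach only the even places.
      zeroAt-fromEnd : ∀ t k → k + t * 2 ≡ suc s → ZeroAt k
      zeroAt-fromEnd zero k e = zeroAt-end (≡.trans (≡.sym (ℕ.+-identityʳ k)) e)
      zeroAt-fromEnd (suc t) k e = zeroAt-step⁻¹ k k<s (zeroAt-fromEnd t (suc (suc k)) e′)
        where
        e′ : suc (suc k) + t * 2 ≡ suc s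
        e′ = ≡.trans (≡.sym (≡.trans (ℕ.+-suc k _) (≡.cong suc (ℕ.+-suc k _)))) e
        k<s : k < s
        k<s = ≡.subst (k <_) (ℕ.suc-injective e′) (s≤s (ℕ.m≤m+n k (t * 2)))

      zeroAt : ∀ k → ZeroAt k
      zeroAt k at with halve k
      ... | j , inj₁ ≡.refl = zeroAt-even j at
      -- From place 2j + 1 to place 2l + 1 there are l - j steps of 2, and j ≤ l because the place
      -- lies on the path.
      ... | j , inj₂ ≡.refl = zeroAt-fromEnd (l ∸ j) (suc (j * 2)) (≡.cong suc (≡.trans
        (≡.sym (ℕ.*-distribʳ-+ 2 j (l ∸ j)))
        (≡.cong (_* 2) (ℕ.m+[n∸m]≡n (ℕ.*-cancelʳ-≤ j l 2 (ℕ.≤-pred (pathAt-≤ at))))))) at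

      X-zero : ∀ e → X e ≈ℝ 0ℝ
      X-zero (u i) = U.cycle-zero (zeroAt 1) i
      X-zero (v i) = zeroAt (suc (toℕ i)) internal
      X-zero (w i) = W.cycle-zero (zeroAt s) i

    kernel-trivial : ∀ j → x j ≈ℝ 0ℝ
    kernel-trivial j = ≡.subst (λ k → x k ≈ℝ 0ℝ) (strictlyInverseʳ j) (X-zero (to j))

dumbbell-fullPVertices : (m n l : ℕ) → 0 < m → 0 < n →
  ∀ {N} (P : SignPattern N) (P-sym : SymmetricPattern P) → NonnegativePattern P →
  underlyingGraph P P-sym ≅ dumbbell (suc (m + m) * 2) (suc (n + n) * 2) (l * 2) →
  RequiresFullPVertices P
dumbbell-fullPVertices m n l 0<m 0<n {suc N} P P-sym nonnegative iso A A∈Q j =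
  1 , 0 ,
  multiplicity-1 (deleteRowCol A j) Deletion.charPoly-0≈0 Deletion.charPoly-1≉0 ,
  multiplicity-0 A (charPoly-0≉0 A injective) ,
  ≡.refl
  where
  open CharacteristicPolynomial ℝ-commutativeRing using (multiplicity-0; multiplicity-1)
  open LinearSystems ℝ-commutativeRing ℝ-isStableDomain
  open Dumbbell m n l using (colour; ~-colour)
  open Inverse (_≅_.vertices iso) using (to)

  injective : Injective A
  injective = Dumbbell.Kernel.kernel-trivial m n l 0<m 0<n P P-sym nonnegative iso A A∈Q

  bipartite : ∀ i k → colour (to i) ≡ colour (to k) → A i k ≈ℝ 0ℝ
  bipartite i k eq with nonnegative i k | proj₂ A∈Q i k
  ... | inj₂ P≡zer | s rewrite P≡zer = s
  ... | inj₁ P≡pos | _ = contradiction eq (~-colour (Equivalence.to (_≅_.adjacency iso i k)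
    (≡.subst (_≢ zer) (≡.sym P≡pos) λ ())))

  module Deletion = VertexDeletion (λ x → ℝ-definite x) A (proj₁ A∈Q) injective (colour ∘ to) bipartite j

4p+2≡ : ∀ p → 4 * p + 2 ≡ suc (p + p) * 2
4p+2≡ = solve 1 (λ p → con 4 :* p :+ con 2 := (con 1 :+ (p :+ p)) :* con 2) ≡.refl
  where open ℕSolver.+-*-Solver

theorem3p8 : (p q l : ℕ) → 0 < p → 0 < q → 0 < l →
    ∀ {N} (P : SignPattern N) (P-sym : SymmetricPattern P) →
    NonnegativePattern P → ZeroDiagonal P →
    underlyingGraph P P-sym ≅ dumbbell (4 * p + 2) (4 * q + 2) (2 * l) →
    RequiresFullPVertices P
theorem3p8 p q l 0<p 0<q _ P P-sym nonnegative _ iso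
  rewrite 4p+2≡ p | 4p+2≡ q | ℕ.*-comm 2 l =
  dumbbell-fullPVertices p q l 0<p 0<q P P-sym nonnegative iso
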